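{- Let $\mathbf{FQSym}$ denote the $\mathbb{K}$-span of the $\mathbf{G}_\sigma$, $\sigma\in\mathfrak{S}_n$, $n\ge1$, equipped with the product $\#$ (an associative algebra with unit $\mathbf{G}_1$). Then $(\mathbf{FQSym},\#)$ is a free associative unital algebra, freely generated by $\{\mathbf{S}^\alpha:\alpha\text{ non-secable}\}$, and also freely generated by $\{\mathbf{G}_\alpha:\alpha\text{ non-secable}\}$.
   Context: Let $A=\{a_1<a_2<\cdots\}$ be an infinite totally ordered alphabet and $\mathbb{K}$ a field; work with formal $\mathbb{K}$-linear combinations of nonempty words over $A$. The $\#$ product of words is $(ux)\#(yv)=uxv$ if the letters $x,y$ are equal and $0$ otherwise ($u,v$ words, $x,y$ letters), extended bilinearly. $\mathrm{std}(w)$ is the standardization of a word $w$ (number left to right the occurrences of the smallest letter $1,2,\dots$, then those of the next letter, etc.), and $\mathbf{G}_\sigma=\sum_{\mathrm{std}(w)=\sigma}w$. With $\mathrm{Inv}(\sigma)=\{(i,j):i<j,\ \sigma_i>\sigma_j\}$, the left weak order is $\sigma\le\tau$ iff $\mathrm{Inv}(\sigma)\subseteq\mathrm{Inv}(\tau)$, and $\mathbf{S}^\sigma=\sum_{\tau\le\sigma}\mathbf{G}_\tau$. A permutation $\alpha\in\mathfrak{S}_n$ is non-secable if $n\ge2$ and for every $k$ with $2\le k<n$, the set $\{\alpha_1,\dots,\alpha_k\}$ is not the union of an interval of integers with maximal element $\alpha_k$ and another interval of integers which is either empty or has maximal element $n$. -}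

module Defs where

open import Level using (Level; _⊔_) renaming (suc to lsuc)
open import Data.Nat using (ℕ; zero; suc; _∸_; _≤_; _<_; _<ᵇ_; _≡ᵇ_)
open import Data.Bool using (Bool; true; false; if_then_else_; _∧_; _∨_; not)
open import Data.List using (List; []; _∷_; length; take; drop; map; upTo; filter; foldr; concatMap)
open import Data.Bool.ListAction using (all; any)
open import Data.List.Properties using (≡-dec)
open import Data.List.Membership.Propositional using (_∈_)
open import Data.List.Relation.Unary.All using (All)
open import Data.List.Relation.Unary.Unique.Propositional using (Unique)
open import Data.List.Relation.Binary.Permutation.Propositional using (_↭_)
open import Data.Maybe using (Maybe; just; nothing)
open import Data.Product using (Σ; ∃; _×_; _,_; proj₁; proj₂)
open import Data.Sum using (_⊎_)
open import Data.Empty using (⊥)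
open import Relation.Nullary using (¬_; yes; no)
open import Relation.Binary.PropositionalEquality using (_≡_)
open import Function.Bundles using (_⇔_)
open import Algebra.Bundles using (CommutativeRing)
import Data.Nat as ℕ

record Field (c ℓ : Level) : Set (lsuc (c ⊔ ℓ)) where
  field
    commutativeRing : CommutativeRing c ℓ
  open CommutativeRing commutativeRing public
  field
    1≉0     : ¬ (1# ≈ 0#)
    inverse : ∀ x → ¬ (x ≈ 0#) → ∃ λ y → (x * y) ≈ 1#

-- Alphabet A = {a₁ < a₂ < …} is modelled by ℕ with its usual order;
-- words are lists of letters (the series below only ever charge
-- nonempty words).

Word : Set
Word = List ℕ

IsPerm : List ℕ → Set
IsPerm σ = σ ↭ map suc (upTo (length σ))

at : List ℕ → ℕ → ℕ
at []       _       = 0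
at (x ∷ _)  zero    = x
at (_ ∷ xs) (suc i) = at xs i

count : (ℕ → Bool) → List ℕ → ℕ
count p []       = 0
count p (x ∷ xs) = if p x then suc (count p xs) else count p xs

-- Standardization: the letter at position i gets the label
-- 1 + #{j : w_j < w_i} + #{j < i : w_j = w_i}
-- (occurrences of the smallest letter numbered left to right, then the next letter, ...).
std : Word → List ℕ
std w = map label (upTo (length w))
  where
  label : ℕ → ℕ
  label i = suc (count (λ y → y <ᵇ at w i) w
                 ℕ.+ count (λ y → y ≡ᵇ at w i) (take i w))

Inv : List ℕ → List (ℕ × ℕ)
Inv σ = concatMap (λ j → map (λ i → (i , j))
                         (filter (λ i → at σ j ℕ.<? at σ i) (upTo j)))
                  (upTo (length σ))

pairEqᵇ : ℕ × ℕ → ℕ × ℕ → Bool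
pairEqᵇ (a , b) (c , d) = (a ≡ᵇ c) ∧ (b ≡ᵇ d)

-- left weak order: σ ≤ τ iff Inv(σ) ⊆ Inv(τ) (for permutations of the same size)
weakLeᵇ : List ℕ → List ℕ → Bool
weakLeᵇ σ τ = (length σ ≡ᵇ length τ)
              ∧ all (λ p → any (pairEqᵇ p) (Inv τ)) (Inv σ)

module FQSymDefs {c ℓ : Level} (K : Field c ℓ) where
  open Field K

  Series : Set c
  Series = Word → Carrier

  sumL : List Carrier → Carrier
  sumL = foldr _+_ 0#

  -- coefficient of w in f # g : w = u x v arises exactly from the pairs
  -- (ux, xv) with |ux| = k ∈ {1..|w|}, i.e. (take k w, drop (k-1) w).
  _#_ : Series → Series → Series
  (f # g) w = sumL (map (λ k → f (take k w) * g (drop (k ∸ 1) w))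
                        (map suc (upTo (length w))))

  G : List ℕ → Series
  G σ w with ≡-dec ℕ._≟_ (std w) σ
  ... | yes _ = 1#
  ... | no  _ = 0#

  -- S^σ = Σ_{τ ≤ σ} G_τ ; its coefficient on w is 1 iff std(w) ≤ σ
  -- (each word has exactly one standardization).
  S : List ℕ → Series
  S σ w = if weakLeᵇ (std w) σ then 1# else 0#

  lincomb : {X : Set} → (X → Series) → List (Carrier × X) → Series
  lincomb e []             w = 0#
  lincomb e ((a , x) ∷ l)  w = (a * e x w) + lincomb e l w

  InSpan : {X : Set} → (X → Set) → (X → Series) → Series → Set (c ⊔ ℓ)
  InSpan P e f = Σ (List (Carrier × _)) λ l →
                   All (λ p → P (proj₂ p)) l × (∀ w → f w ≈ lincomb e l w)

  LinIndep : {X : Set} → (X → Set) → (X → Series) → Set (c ⊔ ℓ)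
  LinIndep P e = ∀ l → All (λ p → P (proj₂ p)) l → Unique (map proj₂ l)
                 → (∀ w → lincomb e l w ≈ 0#) → All (λ p → proj₁ p ≈ 0#) l

  PosPerm : List ℕ → Set
  PosPerm σ = IsPerm σ × 1 ≤ length σ

  InFQSym : Series → Set (c ⊔ ℓ)
  InFQSym = InSpan PosPerm G

  -- noncommutative monomials in generators; the empty monomial is the unit G_1
  evalMon : (List ℕ → Series) → List (List ℕ) → Series
  evalMon gen []       = G (1 ∷ [])
  evalMon gen (α ∷ m)  = gen α # evalMon gen m

  -- (FQSym, #) is freely generated (as unital associative algebra) by
  -- {gen α : P α}: the monomials in the generators are elements of FQSym,
  -- they span FQSym, and distinct monomials are linearly independent.
  FreelyGenerated : (List ℕ → Set) → (List ℕ → Series) → Set (c ⊔ ℓ)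
  FreelyGenerated P gen =
      (∀ m → All P m → InFQSym (evalMon gen m))
    × (∀ σ → PosPerm σ → InSpan (All P) (evalMon gen) (G σ))
    × LinIndep (All P) (evalMon gen)

-- {x : a ≤ x ≤ b} ∪ J, J empty (nothing) or the interval [b', n] (just b')
InUnion : ℕ → ℕ → Maybe ℕ → ℕ → ℕ → Set
InUnion a b nothing   n x = a ≤ x × x ≤ b
InUnion a b (just b') n x = (a ≤ x × x ≤ b) ⊎ (b' ≤ x × x ≤ n)

-- {α₁,…,α_k} = I ∪ J with I a (nonempty) integer interval with maximum α_k
-- and J empty or an integer interval with maximum n
SecableAt : List ℕ → ℕ → Set
SecableAt α k = Σ ℕ λ a → Σ (Maybe ℕ) λ J →
    a ≤ at α (k ∸ 1)
  × (∀ x → (x ∈ take k α) ⇔ InUnion a (at α (k ∸ 1)) J (length α) x)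
  × (∀ b' → J ≡ just b' → b' ≤ length α)

NonSecable : List ℕ → Set
NonSecable α = IsPerm α × 2 ≤ length α
             × (∀ k → 2 ≤ k → k < length α → ¬ SecableAt α k)

{-# OPTIONS --safe #-}
-- Call position c of a permutation a cut if it is never the middle of a pattern 213 or 132; for
-- 1 < k < n, secability at k means that the k-th position is a cut. Chopping a permutation σ at
-- all its cuts (adjacent blocks share the letter at the cut) and standardizing gives a list m(σ)
-- of non-secable permutations, and m is a bijection onto such lists: blocks can be glued back
-- along a common letter, in only one way if that letter is to be a cut. At a cut, an inversion
-- between the two sides is forced or allowed exactly as the inversions with the cut letter
-- dictate, so σ is the largest permutation having given blocks. Hence the monomial m(σ), in
-- either family of generators, is 1 on σ and vanishes off the interval below σ in the weak order:
-- it is unitriangular with respect to the basis G, by induction on the number of inversions.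

module Submission where

open import Level using (Level)
open import Data.Bool using (Bool; true; false; if_then_else_; _∧_; _∨_; T)
open import Data.Bool.Properties using (T-∧; T-∨)
open import Data.Empty using (⊥-elim)
open import Data.List using (List; []; _∷_; _++_; length; take; drop; map; filter; upTo; applyUpTo; cartesianProductWith; deduplicate)
open import Data.List.Extrema.Nat using (max; xs≤max; max<v⁺)
open import Data.List.Membership.Propositional using (_∈_; find; lose)
open import Data.List.Membership.Propositional.Properties
open import Data.List.Properties using (≡-dec; length-++; length-map; length-take; length-drop; length-upTo; length-applyUpTo; map-id; map-∘; map-upTo; map-applyUpTo)
open import Data.List.Relation.Binary.Permutation.Propositional as ↭ using (_↭_; ↭-sym; ↭-trans; ↭⇒↭ₛ; prep)
open import Data.List.Relation.Binary.Permutation.Propositional.Properties using (shift; ∈-resp-↭; ↭-length)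
open import Data.List.Relation.Unary.All as All using (All; []; _∷_)
import Data.List.Relation.Unary.All.Properties as All
open import Data.List.Relation.Unary.Any as Any using (Any; here; there)
open import Data.List.Relation.Unary.Any.Properties using (any⁺; any⁻)
open import Data.List.Relation.Unary.Unique.Propositional using (Unique; []; _∷_)
open import Data.List.Relation.Unary.Unique.Propositional.Properties using (applyUpTo⁺₁)
open import Data.Maybe using (just; nothing)
open import Data.Nat
open import Data.Nat.Induction using (<-wellFounded)
open import Data.Nat.ListAction using (sum)
open import Data.Nat.Properties
open import Data.Product using (∃; _×_; _,_; proj₁; proj₂)
open import Data.Sum using (_⊎_; inj₁; inj₂; [_,_]′)
open import Function using (_∘_; id)
open import Function.Bundles using (mk⇔; Equivalence)
open import Induction.WellFounded using (Acc; acc)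
open import Relation.Binary.Definitions using (tri<; tri≈; tri>)
open import Relation.Binary.PropositionalEquality hiding ([_])
open import Relation.Nullary using (¬_; Dec; yes; no; contradiction)
open import Relation.Nullary.Decidable using (map′; _→-dec_; _×-dec_)
open import Data.List.Relation.Binary.Permutation.Setoid.Properties (setoid ℕ) using (Unique-resp-↭)
open import Data.List.Relation.Unary.Unique.DecPropositional.Properties (≡-dec _≟_) using (deduplicate-!)
open import Defs

-- Lists by position

at-map : ∀ (f : ℕ → ℕ) xs {i} → i < length xs → at (map f xs) i ≡ f (at xs i)
at-map f (x ∷ xs) {zero}  _ = refl
at-map f (x ∷ xs) {suc i} (s≤s i<) = at-map f xs i<

at-applyUpTo : ∀ (f : ℕ → ℕ) n {i} → i < n → at (applyUpTo f n) i ≡ f i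
at-applyUpTo f (suc n) {zero}  _ = refl
at-applyUpTo f (suc n) {suc i} (s≤s i<) = at-applyUpTo (f ∘ suc) n i<

at-take : ∀ k xs {i} → i < k → at (take k xs) i ≡ at xs i
at-take (suc k) []       _ = refl
at-take (suc k) (x ∷ xs) {zero}  _ = refl
at-take (suc k) (x ∷ xs) {suc i} (s≤s i<k) = at-take k xs i<k

at-drop : ∀ k xs i → at (drop k xs) i ≡ at xs (k + i)
at-drop zero    xs       i = refl
at-drop (suc k) []       i = refl
at-drop (suc k) (x ∷ xs) i = at-drop k xs i

at-∈ : ∀ xs {i} → i < length xs → at xs i ∈ xs
at-∈ (x ∷ xs) {zero}  _ = here refl
at-∈ (x ∷ xs) {suc i} (s≤s i<) = there (at-∈ xs i<)

∈-at : ∀ {x xs} → x ∈ xs → ∃ λ i → i < length xs × x ≡ at xs i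
∈-at (here refl) = 0 , z<s , refl
∈-at (there x∈) with i , i< , eq ← ∈-at x∈ = suc i , s<s i< , eq

at-ext : ∀ xs ys → length xs ≡ length ys → (∀ {i} → i < length xs → at xs i ≡ at ys i) → xs ≡ ys
at-ext []       []       _   _  = refl
at-ext (x ∷ xs) (y ∷ ys) len eq =
  cong₂ _∷_ (eq z<s) (at-ext xs ys (suc-injective len) (eq ∘ s<s))

<-length-take : ∀ k (xs : Word) {i} → i < length (take k xs) → i < k × i < length xs
<-length-take k xs {i} i< rewrite length-take k xs = m<n⊓o⇒m<n _ _ i< , m<n⊓o⇒m<o _ _ i<

length-take-≤ : ∀ {k} (xs : Word) → k ≤ length xs → length (take k xs) ≡ k
length-take-≤ {k} xs k≤ = trans (length-take k xs) (m≤n⇒m⊓n≡m k≤)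

<-length-drop : ∀ k (xs : Word) {i} → i < length (drop k xs) → k + i < length xs
<-length-drop k xs {i} i< rewrite length-drop k xs =
  subst (_≤ length xs) (+-suc k i) (subst (_≤ length xs) (+-comm (suc i) k) (m≤o∸n⇒m+n≤o (suc i) k≤ i<))
  where
  k≤ : k ≤ length xs
  k≤ with ≤-total k (length xs)
  ... | inj₁ p = p
  ... | inj₂ p = contradiction (subst (i <_) (m≤n⇒m∸n≡0 p) i<) λ ()

unique⇒at-≢ : ∀ {xs} → Unique xs → ∀ {i j} → i < j → j < length xs → at xs i ≢ at xs j
unique⇒at-≢ {x ∷ xs} (x∉ ∷ _) {zero}  {suc j} _ (s≤s j<) = All.lookup x∉ (at-∈ xs j<)
unique⇒at-≢ {x ∷ xs} (_ ∷ u)  {suc i} {suc j} (s≤s i<j) (s≤s j<) = unique⇒at-≢ u i<j j<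

-- Pigeonhole: each head of `xs` is located in `ys` and removed from it. Distinctness keeps the tail
-- inside what is left, and the length bound forces `ys` to run out together with `xs`.
unique-⊆⇒↭ : {A : Set} {xs ys : List A} → Unique xs → (∀ {x} → x ∈ xs → x ∈ ys) →
             length ys ≤ length xs → xs ↭ ys
unique-⊆⇒↭ {xs = []} {[]} _ _ _ = ↭.refl
unique-⊆⇒↭ {xs = x ∷ xs} (x∉ ∷ u) xs⊆ys len with ys₁ , ys₂ , refl ← ∈-∃++ (xs⊆ys (here refl)) =
  ↭-trans (prep x (unique-⊆⇒↭ u xs⊆ (s≤s⁻¹ (≤-trans (≤-reflexive (sym (↭-length shifted))) len)))) (↭-sym shifted)
  where
  shifted = shift x ys₁ ys₂
  xs⊆ : ∀ {z} → z ∈ xs → z ∈ ys₁ ++ ys₂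
  xs⊆ z∈ with ∈-resp-↭ shifted (xs⊆ys (there z∈))
  ... | here refl = contradiction refl (All.lookup x∉ z∈)
  ... | there z∈′ = z∈′

-- Counting by position

-- Ranks and inversion numbers are both written as sums of 0/1 terms over positions, so that they
-- can be compared term by term, one strict term giving a strict inequality.
∑< : ℕ → (ℕ → ℕ) → ℕ
∑< zero    f = 0
∑< (suc n) f = f 0 + ∑< n (f ∘ suc)

∑<-mono : ∀ n {f g} → (∀ {i} → i < n → f i ≤ g i) → ∑< n f ≤ ∑< n g
∑<-mono zero    _   = z≤n
∑<-mono (suc n) f≤g = +-mono-≤ (f≤g z<s) (∑<-mono n (f≤g ∘ s<s))

∑<-cong : ∀ n {f g} → (∀ {i} → i < n → f i ≡ g i) → ∑< n f ≡ ∑< n g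
∑<-cong zero    _   = refl
∑<-cong (suc n) f≡g = cong₂ _+_ (f≡g z<s) (∑<-cong n (f≡g ∘ s<s))

∑<-strict : ∀ n {f g} → (∀ {i} → i < n → f i ≤ g i) → ∀ {k} → k < n → f k < g k → ∑< n f < ∑< n g
∑<-strict (suc n) f≤g {zero}  _         lt = +-mono-<-≤ lt (∑<-mono n (f≤g ∘ s<s))
∑<-strict (suc n) f≤g {suc k} (s≤s k<n) lt = +-mono-≤-< (f≤g z<s) (∑<-strict n (f≤g ∘ s<s) k<n lt)

∑<-+ : ∀ n f g → ∑< n f + ∑< n g ≡ ∑< n (λ i → f i + g i)
∑<-+ zero    f g = refl
∑<-+ (suc n) f g = trans (+-assoc-middle (f 0) _ (g 0) _) (cong (f 0 + g 0 +_) (∑<-+ n (f ∘ suc) (g ∘ suc)))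
  where
  +-assoc-middle : ∀ a b c d → (a + b) + (c + d) ≡ (a + c) + (b + d)
  +-assoc-middle a b c d = begin
    (a + b) + (c + d) ≡⟨ +-assoc a b (c + d) ⟩
    a + (b + (c + d)) ≡⟨ cong (a +_) (+-assoc b c d) ⟨
    a + ((b + c) + d) ≡⟨ cong (λ z → a + (z + d)) (+-comm b c) ⟩
    a + ((c + b) + d) ≡⟨ cong (a +_) (+-assoc c b d) ⟩
    a + (c + (b + d)) ≡⟨ +-assoc a c (b + d) ⟨
    (a + c) + (b + d) ∎ where open ≡-Reasoning

∑<-const : ∀ n c → ∑< n (λ _ → c) ≡ n * c
∑<-const zero    c = refl
∑<-const (suc n) c = cong (c +_) (∑<-const n c)

∑<-zero : ∀ n → ∑< n (λ _ → 0) ≡ 0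
∑<-zero n = trans (∑<-const n 0) (*-zeroʳ n)

∑<-one : ∀ n → ∑< n (λ _ → 1) ≡ n
∑<-one n = trans (∑<-const n 1) (*-identityʳ n)

[_] : Bool → ℕ
[ b ] = if b then 1 else 0

[]-mono : ∀ {b b′} → (T b → T b′) → [ b ] ≤ [ b′ ]
[]-mono {false}        _ = z≤n
[]-mono {true} {true}  _ = ≤-refl
[]-mono {true} {false} f = ⊥-elim (f _)

[]-strict : ∀ {b b′} → ¬ T b → T b′ → [ b ] < [ b′ ]
[]-strict {true}          ¬b _ = ⊥-elim (¬b _)
[]-strict {false} {true}  _  _ = ≤-refl

count-at : ∀ p w → count p w ≡ ∑< (length w) (λ i → [ p (at w i) ])
count-at p []      = refl
count-at p (x ∷ w) with p x
... | true  = cong suc (count-at p w)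
... | false = count-at p w

-- The truncation becomes a condition on the position, so that this count runs over the whole word
-- and can be added termwise to the one of `count-at`.
count-take-at : ∀ p k w → count p (take k w) ≡ ∑< (length w) (λ i → [ p (at w i) ∧ (i <ᵇ k) ])
count-take-at p zero    w = sym (trans (∑<-cong (length w) (λ {i} _ → false-right (p (at w i)))) (∑<-zero (length w)))
  where
  false-right : ∀ b → [ b ∧ false ] ≡ 0
  false-right true  = refl
  false-right false = refl
count-take-at p (suc k) []      = refl
count-take-at p (suc k) (x ∷ w) with p x
... | true  = cong suc (count-take-at p k w)
... | false = count-take-at p k w

-- Standardization

-- The strict order in which standardization numbers positions: by letter, ties from left to right.
-- `Before w i l` means that position `l` is numbered before position `i`.
Before : Word → ℕ → ℕ → Set
Before w i l = at w l < at w i ⊎ at w l ≡ at w i × l < i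

beforeᵇ : Word → ℕ → ℕ → Bool
beforeᵇ w i l = (at w l <ᵇ at w i) ∨ ((at w l ≡ᵇ at w i) ∧ (l <ᵇ i))

before⁺ : ∀ w {i l} → Before w i l → T (beforeᵇ w i l)
before⁺ w (inj₁ lt)        = Equivalence.from T-∨ (inj₁ (<⇒<ᵇ lt))
before⁺ w (inj₂ (eq , lt)) = Equivalence.from T-∨ (inj₂ (Equivalence.from T-∧ (≡⇒≡ᵇ _ _ eq , <⇒<ᵇ lt)))

before⁻ : ∀ w {i l} → T (beforeᵇ w i l) → Before w i l
before⁻ w t with Equivalence.to T-∨ t
... | inj₁ lt = inj₁ (<ᵇ⇒< _ _ lt)
... | inj₂ t′ with eq , lt ← Equivalence.to T-∧ t′ = inj₂ (≡ᵇ⇒≡ _ _ eq , <ᵇ⇒< _ _ lt)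

before-irrefl : ∀ w {i} → ¬ Before w i i
before-irrefl w (inj₁ lt)       = <-irrefl refl lt
before-irrefl w (inj₂ (_ , lt)) = <-irrefl refl lt

before-trans : ∀ w {i j l} → Before w i j → Before w j l → Before w i l
before-trans w (inj₁ p)        (inj₁ q)        = inj₁ (<-trans q p)
before-trans w (inj₁ p)        (inj₂ (q , _))  = inj₁ (≤-<-trans (≤-reflexive q) p)
before-trans w (inj₂ (p , _))  (inj₁ q)        = inj₁ (<-≤-trans q (≤-reflexive p))
before-trans w (inj₂ (p , p′)) (inj₂ (q , q′)) = inj₂ (trans q p , <-trans q′ p′)

rank : Word → ℕ → ℕ
rank w i = ∑< (length w) (λ l → [ beforeᵇ w i l ])

length-std : ∀ w → length (std w) ≡ length w
length-std w = trans (length-map _ (upTo (length w))) (length-upTo (length w))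

-- The two counts concern disjoint sets of positions, smaller letters and earlier equal letters,
-- whose union is the set of positions before `i`.
counts≡rank : ∀ w i → count (λ y → y <ᵇ at w i) w + count (λ y → y ≡ᵇ at w i) (take i w) ≡ rank w i
counts≡rank w i = begin
  count (λ y → y <ᵇ at w i) w + count (λ y → y ≡ᵇ at w i) (take i w)
    ≡⟨ cong₂ _+_ (count-at _ w) (count-take-at _ i w) ⟩
  ∑< n (λ l → [ at w l <ᵇ at w i ]) + ∑< n (λ l → [ (at w l ≡ᵇ at w i) ∧ (l <ᵇ i) ])
    ≡⟨ ∑<-+ n _ _ ⟩
  ∑< n (λ l → [ at w l <ᵇ at w i ] + [ (at w l ≡ᵇ at w i) ∧ (l <ᵇ i) ])
    ≡⟨ ∑<-cong n (λ {l} _ → disjoint (at w l <ᵇ at w i) _ (exclusive l)) ⟩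
  rank w i ∎
  where
  open ≡-Reasoning
  n = length w
  disjoint : ∀ b b′ → (T b → ¬ T b′) → [ b ] + [ b′ ] ≡ [ b ∨ b′ ]
  disjoint false b′    _ = refl
  disjoint true  false _ = refl
  disjoint true  true  f = ⊥-elim (f _ _)
  exclusive : ∀ l → T (at w l <ᵇ at w i) → ¬ T ((at w l ≡ᵇ at w i) ∧ (l <ᵇ i))
  exclusive l lt t = <-irrefl (≡ᵇ⇒≡ (at w l) _ (proj₁ (Equivalence.to T-∧ t))) (<ᵇ⇒< _ _ lt)

std≡ranks : ∀ w → std w ≡ applyUpTo (suc ∘ rank w) (length w)
std≡ranks w = at-ext _ _ (trans (length-std w) (sym (length-applyUpTo _ (length w)))) λ {i} i< →
  let i<n = subst (i <_) (length-std w) i< in begin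
  at (std w) i                                  ≡⟨ at-map _ (upTo (length w)) (subst (i <_) (sym (length-upTo (length w))) i<n) ⟩
  _                                             ≡⟨ cong (λ k → suc (count (λ y → y <ᵇ at w k) w + count (λ y → y ≡ᵇ at w k) (take k w))) (at-applyUpTo id (length w) i<n) ⟩
  _                                             ≡⟨ cong suc (counts≡rank w i) ⟩
  suc (rank w i)                                ≡⟨ at-applyUpTo _ (length w) i<n ⟨
  at (applyUpTo (suc ∘ rank w) (length w)) i    ∎
  where open ≡-Reasoning

at-std : ∀ w {i} → i < length w → at (std w) i ≡ suc (rank w i)
at-std w i< = trans (cong (λ s → at s _) (std≡ranks w)) (at-applyUpTo _ (length w) i<)

-- By transitivity every position before `l` is before `i`; moreover `l` is before `i` but not
-- before itself, which gives the strict term.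
rank-strict : ∀ w {i l} → l < length w → Before w i l → rank w l < rank w i
rank-strict w l< b = ∑<-strict (length w)
  (λ _ → []-mono (λ t → before⁺ w (before-trans w b (before⁻ w t)))) l<
  ([]-strict (before-irrefl w ∘ before⁻ w) (before⁺ w b))

rank-bound : ∀ w {i} → i < length w → rank w i < length w
rank-bound w {i} i< = subst (rank w i <_) (∑<-one (length w))
  (∑<-strict (length w) (λ _ → []-mono {b′ = true} _) i< ([]-strict {b′ = true} (before-irrefl w ∘ before⁻ w) _))

-- The weak order on words, through the inversions of their standardizations

infix 4 _≼_ _≈ʷ_

-- Stated for arbitrary words by comparing positions, so that prefixes and suffixes inherit it
-- without being standardized again. The inequalities are strict because equal letters are numbered
-- from left to right and create no inversion.
record _≼_ (u w : Word) : Set where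
  constructor _,≼_
  field
    same-length : length u ≡ length w
    inversions  : ∀ {i j} → i < j → j < length u → at u j < at u i → at w j < at w i
open _≼_ public

_≈ʷ_ : Word → Word → Set
u ≈ʷ w = u ≼ w × w ≼ u

≼-trans : ∀ {u v w} → u ≼ v → v ≼ w → u ≼ w
≼-trans (len ,≼ f) (len′ ,≼ g) =
  trans len len′ ,≼ λ i<j j< → g i<j (subst (_ <_) len j<) ∘ f i<j j<

≈ʷ-sym : ∀ {u w} → u ≈ʷ w → w ≈ʷ u
≈ʷ-sym (p , q) = q , p

≈ʷ-trans : ∀ {u v w} → u ≈ʷ v → v ≈ʷ w → u ≈ʷ w
≈ʷ-trans (p , q) (p′ , q′) = ≼-trans p p′ , ≼-trans q′ q

≼-take : ∀ k {u w} → u ≼ w → take k u ≼ take k w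
≼-take k {u} {w} (len ,≼ f) =
  trans (length-take k u) (trans (cong (k ⊓_) len) (sym (length-take k w))) ,≼ λ i<j j< lt →
  let j<k , j<u = <-length-take k u j<
      i<k = <-trans i<j j<k
  in subst₂ _<_ (sym (at-take k w j<k)) (sym (at-take k w i<k))
       (f i<j j<u (subst₂ _<_ (at-take k u j<k) (at-take k u i<k) lt))

≼-drop : ∀ k {u w} → u ≼ w → drop k u ≼ drop k w
≼-drop k {u} {w} (len ,≼ f) =
  trans (length-drop k u) (trans (cong (_∸ k) len) (sym (length-drop k w))) ,≼ λ {i} {j} i<j j< lt →
  subst₂ _<_ (sym (at-drop k w j)) (sym (at-drop k w i))
    (f (+-monoʳ-< k i<j) (<-length-drop k u j<) (subst₂ _<_ (at-drop k u j) (at-drop k u i) lt))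

≈ʷ-take : ∀ k {u w} → u ≈ʷ w → take k u ≈ʷ take k w
≈ʷ-take k (p , q) = ≼-take k p , ≼-take k q

≈ʷ-drop : ∀ k {u w} → u ≈ʷ w → drop k u ≈ʷ drop k w
≈ʷ-drop k (p , q) = ≼-drop k p , ≼-drop k q

-- A larger letter receives a larger label. Conversely, for `i < j`, an equal or larger letter at
-- `j` makes `i` come before `j`, so the labels are not inverted there.
std-≈ʷ : ∀ w → w ≈ʷ std w
std-≈ʷ w =
    (sym (length-std w) ,≼ λ i<j j< lt → at-std-< (<-trans i<j j<) j< (rank-strict w j< (inj₁ lt)))
  , (length-std w ,≼ λ i<j j<s lt → back i<j (subst (_ <_) (length-std w) j<s) lt)
  where
  at-std-< : ∀ {i j} → i < length w → j < length w → rank w j < rank w i → at (std w) j < at (std w) i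
  at-std-< i< j< lt = subst₂ _<_ (sym (at-std w j<)) (sym (at-std w i<)) (s<s lt)
  back : ∀ {i j} → i < j → j < length w → at (std w) j < at (std w) i → at w j < at w i
  back {i} {j} i<j j< lt with <-cmp (at w j) (at w i)
  ... | tri< p _ _ = p
  ... | tri≈ _ p _ = contradiction lt (<-asym (at-std-< j< (<-trans i<j j<) (rank-strict w (<-trans i<j j<) (inj₂ (sym p , i<j)))))
  ... | tri> _ _ p = contradiction lt (<-asym (at-std-< j< (<-trans i<j j<) (rank-strict w (<-trans i<j j<) (inj₁ p))))

-- `Before` depends on inversions only: a position to the right of `i` is before `i` exactly when
-- the pair is an inversion, and one to the left exactly when it is not.
before-resp : ∀ {u w} → u ≈ʷ w → ∀ {i l} → i < length u → l < length u → Before u i l → Before w i l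
before-resp {u} {w} (p , q) {i} {l} i< l< b with <-cmp l i
... | tri≈ _ refl _ = contradiction b (before-irrefl u)
... | tri> _ _ i<l = inj₁ (inversions p i<l l< (strict b))
  where
  strict : Before u i l → at u l < at u i
  strict (inj₁ lt)        = lt
  strict (inj₂ (_ , l<i)) = contradiction i<l (<-asym l<i)
... | tri< l<i _ _ with <-cmp (at w l) (at w i)
...   | tri< lt _ _ = inj₁ lt
...   | tri≈ _ eq _ = inj₂ (eq , l<i)
...   | tri> _ _ gt = contradiction b λ
  { (inj₁ lt)       → <-asym lt inverted
  ; (inj₂ (eq , _)) → <-irrefl (sym eq) inverted }
  where inverted = inversions q l<i (subst (i <_) (same-length p) i<) gt

-- A label is one plus the number of positions before it, and that number is determined by the
-- inversions. With `std-≈ʷ`, the classes of `≈ʷ` are thus the fibres of `std`.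
std-cong : ∀ {u w} → u ≈ʷ w → std u ≡ std w
std-cong {u} {w} u≈w@(p , q) = at-ext _ _ len λ {i} i<s → let i< = subst (i <_) (length-std u) i<s in begin
  at (std u) i    ≡⟨ at-std u i< ⟩
  suc (rank u i)  ≡⟨ cong suc (≤-antisym (rank-≤ u≈w i<) (rank-≤ (≈ʷ-sym u≈w) (subst (i <_) (same-length p) i<))) ⟩
  suc (rank w i)  ≡⟨ at-std w (subst (i <_) (same-length p) i<) ⟨
  at (std w) i    ∎
  where
  open ≡-Reasoning
  len = trans (length-std u) (trans (same-length p) (sym (length-std w)))
  rank-≤ : ∀ {u w} → u ≈ʷ w → ∀ {i} → i < length u → rank u i ≤ rank w i
  rank-≤ {u} {w} u≈w {i} i< = subst (λ n → rank u i ≤ ∑< n (λ l → [ beforeᵇ w i l ])) (same-length (proj₁ u≈w))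
    (∑<-mono (length u) λ l< → []-mono (before⁺ w ∘ before-resp u≈w i< l< ∘ before⁻ u))

std≡⇒≈ʷ : ∀ {u w} → std u ≡ std w → u ≈ʷ w
std≡⇒≈ʷ {u} {w} eq = ≈ʷ-trans (subst (u ≈ʷ_) eq (std-≈ʷ u)) (≈ʷ-sym (std-≈ʷ w))

std-idem : ∀ w → std (std w) ≡ std w
std-idem w = sym (std-cong (std-≈ʷ w))

-- Permutations

-- The labels are distinct because any two positions are comparable under `Before`, and they lie
-- between 1 and the length; pigeonhole does the rest.
isPerm-std : ∀ w → IsPerm (std w)
isPerm-std w = unique-⊆⇒↭ unique ⊆range (≤-reflexive (trans (length-map suc (upTo n)) (length-upTo n)))
  where
  n = length (std w)
  unique : Unique (std w)
  unique = subst Unique (sym (std≡ranks w)) (applyUpTo⁺₁ _ (length w) distinct)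
    where
    distinct : ∀ {i j} → i < j → j < length w → suc (rank w i) ≢ suc (rank w j)
    distinct {i} {j} i<j j< eq with <-cmp (at w i) (at w j)
    ... | tri< p _ _ = <-irrefl (suc-injective eq) (rank-strict w (<-trans i<j j<) (inj₁ p))
    ... | tri≈ _ p _ = <-irrefl (suc-injective eq) (rank-strict w (<-trans i<j j<) (inj₂ (p , i<j)))
    ... | tri> _ _ p = <-irrefl (sym (suc-injective eq)) (rank-strict w j< (inj₁ p))
  ⊆range : ∀ {x} → x ∈ std w → x ∈ map suc (upTo n)
  ⊆range x∈ with i , i< , refl ← ∈-applyUpTo⁻ _ (subst (_ ∈_) (std≡ranks w) x∈) =
    ∈-map⁺ suc (∈-upTo⁺ (subst (rank w i <_) (sym (length-std w)) (rank-bound w i<)))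

perm-unique : ∀ {σ} → IsPerm σ → Unique σ
perm-unique {σ} p = Unique-resp-↭ (↭⇒↭ₛ (↭-sym p))
  (subst Unique (sym (map-upTo suc (length σ))) (applyUpTo⁺₁ suc (length σ) (λ i<j _ → <⇒≢ (s<s i<j))))

perm-at : ∀ {σ} → IsPerm σ → ∀ {x} → 1 ≤ x → x ≤ length σ → ∃ λ i → i < length σ × x ≡ at σ i
perm-at p {suc x} _ x≤ = ∈-at (∈-resp-↭ (↭-sym p) (∈-map⁺ suc (∈-upTo⁺ x≤)))

perm-range : ∀ {σ} → IsPerm σ → ∀ {x} → x ∈ σ → 1 ≤ x × x ≤ length σ
perm-range p x∈ with _ , y∈ , refl ← ∈-map⁻ suc (∈-resp-↭ p x∈) = z<s , ∈-upTo⁻ y∈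

count-↭ : ∀ p {xs ys} → xs ↭ ys → count p xs ≡ count p ys
count-↭ p ↭.refl = refl
count-↭ p (↭.prep x e) with p x
... | true  = cong suc (count-↭ p e)
... | false = count-↭ p e
count-↭ p (↭.swap x y e) with p x | p y
... | true  | true  = cong (suc ∘ suc) (count-↭ p e)
... | true  | false = cong suc (count-↭ p e)
... | false | true  = cong suc (count-↭ p e)
... | false | false = count-↭ p e
count-↭ p (↭.trans e e′) = trans (count-↭ p e) (count-↭ p e′)

count-range : ∀ n {b} → b ≤ n → count (_<ᵇ suc b) (map suc (upTo n)) ≡ b
count-range n {b} b≤n = begin
  count (_<ᵇ suc b) (map suc (upTo n))                      ≡⟨ cong (count _) (map-upTo suc n) ⟩
  count (_<ᵇ suc b) (applyUpTo suc n)                       ≡⟨ count-at _ (applyUpTo suc n) ⟩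
  ∑< (length (applyUpTo suc n)) (λ i → [ at (applyUpTo suc n) i <ᵇ suc b ])
    ≡⟨ cong (λ m → ∑< m (λ i → [ at (applyUpTo suc n) i <ᵇ suc b ])) (length-applyUpTo suc n) ⟩
  ∑< n (λ i → [ at (applyUpTo suc n) i <ᵇ suc b ])          ≡⟨ ∑<-cong n (λ i<n → cong (λ x → [ x <ᵇ suc b ]) (at-applyUpTo suc n i<n)) ⟩
  ∑< n (λ i → [ i <ᵇ b ])                                   ≡⟨ initial n b≤n ⟩
  b ∎
  where
  open ≡-Reasoning
  initial : ∀ n {b} → b ≤ n → ∑< n (λ i → [ i <ᵇ b ]) ≡ b
  initial n       {zero}  _         = ∑<-zero n
  initial (suc n) {suc b} (s≤s b≤n) = cong suc (initial n b≤n)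

-- The count of smaller letters may be taken over 1, ..., n instead of `σ`, where it is the letter
-- minus one; the count of earlier equal letters is zero.
std-perm : ∀ {σ} → IsPerm σ → std σ ≡ σ
std-perm {σ} p = at-ext _ _ (length-std σ) λ {i} i<s → let i< = subst (i <_) (length-std σ) i<s in begin
  at (std σ) i                                                             ≡⟨ at-std σ i< ⟩
  suc (rank σ i)                                                           ≡⟨ cong suc (counts≡rank σ i) ⟨
  suc (count (_<ᵇ at σ i) σ + count (_≡ᵇ at σ i) (take i σ))               ≡⟨ cong suc (cong₂ _+_ (count-↭ _ p) (no-repeat i<)) ⟩
  suc (count (_<ᵇ at σ i) (map suc (upTo (length σ))) + 0)                 ≡⟨ cong suc (+-identityʳ _) ⟩
  suc (count (_<ᵇ at σ i) (map suc (upTo (length σ))))                     ≡⟨ below (perm-range p (at-∈ σ i<)) ⟩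
  at σ i                                                                   ∎
  where
  open ≡-Reasoning
  below : ∀ {x} → 1 ≤ x × x ≤ length σ → suc (count (_<ᵇ x) (map suc (upTo (length σ)))) ≡ x
  below {suc b} (_ , b<) = cong suc (count-range (length σ) (<⇒≤ b<))
  no-repeat : ∀ {i} → i < length σ → count (_≡ᵇ at σ i) (take i σ) ≡ 0
  no-repeat {i} i< = trans (count-take-at _ i σ) (trans (∑<-cong (length σ) λ {l} _ → zero-at l) (∑<-zero (length σ)))
    where
    zero-at : ∀ l → [ (at σ l ≡ᵇ at σ i) ∧ (l <ᵇ i) ] ≡ 0
    zero-at l = n≤0⇒n≡0 ([]-mono {b′ = false} λ t → let eq , lt = Equivalence.to T-∧ t in
      unique⇒at-≢ (perm-unique p) (<ᵇ⇒< l i lt) i< (≡ᵇ⇒≡ _ _ eq))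

-- Number of inversions

inv : Word → ℕ
inv w = ∑< (length w) λ i → ∑< (length w) λ j → [ (i <ᵇ j) ∧ (at w j <ᵇ at w i) ]

inv-≤ : ∀ w → inv w ≤ length w * length w
inv-≤ w = subst (inv w ≤_) (∑<-const n n)
  (∑<-mono n λ {i} _ → ≤-trans
    (∑<-mono n λ {j} _ → []-mono {(i <ᵇ j) ∧ (at w j <ᵇ at w i)} {true} _)
    (≤-reflexive (∑<-one n)))
  where n = length w

-- The terms of `inv u` are bounded by those of `inv w`, so a single extra inversion of `w` would
-- make `inv u` strictly smaller. Hence a word strictly below another has fewer inversions, the
-- measure behind both final inductions.
≼∧inv-≥⇒≽ : ∀ {u w} → u ≼ w → inv w ≤ inv u → w ≼ u
≼∧inv-≥⇒≽ {u} {w} (len ,≼ f) w≤u = sym len ,≼ λ {i} {j} i<j j< lt →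
  back i<j (subst (j <_) (sym len) j<) lt
  where
  n = length u
  inv-w : inv w ≡ ∑< n λ i → ∑< n λ j → [ (i <ᵇ j) ∧ (at w j <ᵇ at w i) ]
  inv-w = cong (λ n → ∑< n λ i → ∑< n λ j → [ (i <ᵇ j) ∧ (at w j <ᵇ at w i) ]) (sym len)
  pointwise : ∀ {i j} → j < n → [ (i <ᵇ j) ∧ (at u j <ᵇ at u i) ] ≤ [ (i <ᵇ j) ∧ (at w j <ᵇ at w i) ]
  pointwise j< = []-mono λ t → let i<j , lt = Equivalence.to T-∧ t in
    Equivalence.from T-∧ (i<j , <⇒<ᵇ (f (<ᵇ⇒< _ _ i<j) j< (<ᵇ⇒< _ _ lt)))
  back : ∀ {i j} → i < j → j < n → at w j < at w i → at u j < at u i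
  back {i} {j} i<j j< lt with at u j <? at u i
  ... | yes p = p
  ... | no ¬p = contradiction (subst (_≤ inv u) inv-w w≤u) (<⇒≱ (∑<-strict n
    (λ i< → ∑<-mono n pointwise) (<-trans i<j j<)
    (∑<-strict n pointwise j< ([]-strict
      (λ t → ¬p (<ᵇ⇒< _ _ (proj₂ (Equivalence.to (T-∧ {x = i <ᵇ j}) t))))
      (Equivalence.from T-∧ (<⇒<ᵇ i<j , <⇒<ᵇ lt))))))

-- Inversion lists and the Boolean test for the weak order

∈-Inv⁺ : ∀ w {i j} → i < j → j < length w → at w j < at w i → (i , j) ∈ Inv w
∈-Inv⁺ w {i} {j} i<j j< lt = ∈-concatMap⁺ _
  (lose (∈-upTo⁺ j<) (∈-map⁺ _ (∈-filter⁺ (λ i → at w j <? at w i) (∈-upTo⁺ i<j) lt)))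

∈-Inv⁻ : ∀ w {i j} → (i , j) ∈ Inv w → i < j × j < length w × at w j < at w i
∈-Inv⁻ w p∈ with j , j∈ , q∈ ← find (∈-concatMap⁻ _ {xs = upTo (length w)} p∈)
            with i , i∈ , refl ← ∈-map⁻ _ q∈
            with i∈′ , lt ← ∈-filter⁻ (λ i → at w j <? at w i) {xs = upTo j} i∈ = ∈-upTo⁻ i∈′ , ∈-upTo⁻ j∈ , lt

weakLeᵇ⁺ : ∀ {u w} → u ≼ w → T (weakLeᵇ u w)
weakLeᵇ⁺ {u} {w} (len ,≼ f) = Equivalence.from T-∧ (≡⇒≡ᵇ _ _ len ,
  All.all⁻ _ {xs = Inv u} (All.tabulate λ { {i , j} p∈ → let i<j , j< , lt = ∈-Inv⁻ u p∈ in
    any⁺ _ (Any.map (λ { refl → Equivalence.from T-∧ (≡⇒≡ᵇ i i refl , ≡⇒≡ᵇ j j refl) })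
      (∈-Inv⁺ w i<j (subst (j <_) len j<) (f i<j j< lt))) }))

weakLeᵇ⁻ : ∀ {u w} → T (weakLeᵇ u w) → u ≼ w
weakLeᵇ⁻ {u} {w} t with len , incl ← Equivalence.to (T-∧ {x = length u ≡ᵇ length w}) t =
  ≡ᵇ⇒≡ _ _ len ,≼ λ i<j j< lt →
  proj₂ (proj₂ (∈-Inv⁻ w (Any.map same-pair (any⁻ _ (Inv w) (All.lookup (All.all⁺ _ (Inv u) incl) (∈-Inv⁺ u i<j j< lt))))))
  where
  same-pair : ∀ {p q} → T (pairEqᵇ p q) → p ≡ q
  same-pair {i , j} {i′ , j′} t with a , b ← Equivalence.to (T-∧ {x = i ≡ᵇ i′}) t = cong₂ _,_ (≡ᵇ⇒≡ i i′ a) (≡ᵇ⇒≡ j j′ b)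

-- Cuts

-- The letter at position c is never the middle of a pattern 213 or 132, i.e.
-- w is the largest word for _≼_ among those agreeing with it up to c and from c on.
record Cut (w : Word) (c : ℕ) : Set where
  field
    inside : c < length w
    left   : ∀ {i j} → i < c → c < j → j < length w → at w c < at w i → at w j < at w i
    right  : ∀ {i j} → i < c → c < j → j < length w → at w j < at w c → at w j < at w i
open Cut

cut? : ∀ w c → Dec (Cut w c)
cut? w c = map′
  (λ (c< , f) → record
    { inside = c<
    ; left   = λ i<c c<j j< → proj₁ (f i<c j< c<j)
    ; right  = λ i<c c<j j< → proj₂ (f i<c j< c<j) })
  (λ C → inside C , λ {i} i<c {j} j< c<j → left C i<c c<j j< , right C i<c c<j j<)
  ((c <? length w) ×-dec
   allUpTo? (λ i → allUpTo? (λ j → (c <? j) →-dec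
     (((at w c <? at w i) →-dec (at w j <? at w i)) ×-dec
      ((at w j <? at w c) →-dec (at w j <? at w i)))) (length w)) c)

cut-last : ∀ {w c} → length w ≡ suc c → Cut w c
cut-last len = record
  { inside = ≤-reflexive (sym len)
  ; left   = λ _ c<j j< → contradiction c<j (<⇒≱ (subst (_ <_) len j<))
  ; right  = λ _ c<j j< → contradiction c<j (<⇒≱ (subst (_ <_) len j<)) }

cut-resp : ∀ {u w c} → u ≈ʷ w → Cut u c → Cut w c
cut-resp {u} {w} (p , q) C = record
  { inside = subst (_ <_) (same-length p) (inside C)
  ; left   = λ i<c c<j j< lt → let j<u = subst (_ <_) (sym (same-length p)) j< in
      inversions p (<-trans i<c c<j) j<u (left C i<c c<j j<u (inversions q i<c (<-trans c<j j<) lt))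
  ; right  = λ i<c c<j j< lt → let j<u = subst (_ <_) (sym (same-length p)) j< in
      inversions p (<-trans i<c c<j) j<u (right C i<c c<j j<u (inversions q c<j j< lt)) }

cut-take : ∀ {w c} k → c < k → Cut w c → Cut (take k w) c
cut-take {w} {c} k c<k C = record
  { inside = subst (c <_) (sym (length-take k w)) (⊓-pres-m< c<k (inside C))
  ; left   = λ i<c c<j j< lt → let j<k , j<w = <-length-take k w j<; i<k = <-trans i<c c<k in
      subst₂ _<_ (sym (at-take k w j<k)) (sym (at-take k w i<k))
        (left C i<c c<j j<w (subst₂ _<_ (at-take k w c<k) (at-take k w i<k) lt))
  ; right  = λ i<c c<j j< lt → let j<k , j<w = <-length-take k w j<; i<k = <-trans i<c c<k in
      subst₂ _<_ (sym (at-take k w j<k)) (sym (at-take k w i<k))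
        (right C i<c c<j j<w (subst₂ _<_ (at-take k w j<k) (at-take k w c<k) lt)) }

-- A letter beyond `c` is compared with a letter before `b` through the letter at `c`, which is
-- itself a cut. Therefore the prefix ending at the first cut has no inner cut of its own.
cut-untake : ∀ {w b c} → b < c → Cut w c → Cut (take (suc c) w) b → Cut w b
cut-untake {w} {b} {c} b<c C B = record
  { inside = <-trans b<c (inside C)
  ; left   = l
  ; right  = r }
  where
  at-t : ∀ {i} → i ≤ c → at (take (suc c) w) i ≡ at w i
  at-t i≤c = at-take (suc c) w (s≤s i≤c)
  in-t : ∀ {i} → i ≤ c → i < length (take (suc c) w)
  in-t i≤c = subst (_ <_) (sym (length-take-≤ w (inside C))) (s≤s i≤c)
  left-c : ∀ {i j} → i < b → b < j → j ≤ c → at w b < at w i → at w j < at w i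
  left-c i<b b<j j≤c lt = subst₂ _<_ (at-t j≤c) (at-t (<⇒≤ (<-trans i<b b<c)))
    (left B i<b b<j (in-t j≤c) (subst₂ _<_ (sym (at-t (<⇒≤ b<c))) (sym (at-t (<⇒≤ (<-trans i<b b<c)))) lt))
  right-c : ∀ {i j} → i < b → b < j → j ≤ c → at w j < at w b → at w j < at w i
  right-c i<b b<j j≤c lt = subst₂ _<_ (at-t j≤c) (at-t (<⇒≤ (<-trans i<b b<c)))
    (right B i<b b<j (in-t j≤c) (subst₂ _<_ (sym (at-t j≤c)) (sym (at-t (<⇒≤ b<c))) lt))
  l : ∀ {i j} → i < b → b < j → j < length w → at w b < at w i → at w j < at w i
  l {i} {j} i<b b<j j< lt with j ≤? c
  ... | yes j≤c = left-c i<b b<j j≤c lt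
  ... | no  j≰c = left C (<-trans i<b b<c) (≰⇒> j≰c) j< (left-c i<b b<c ≤-refl lt)
  r : ∀ {i j} → i < b → b < j → j < length w → at w j < at w b → at w j < at w i
  r {i} {j} i<b b<j j< lt with j ≤? c | at w c <? at w b
  ... | yes j≤c | _       = right-c i<b b<j j≤c lt
  ... | no  j≰c | yes c<b = left C (<-trans i<b b<c) (≰⇒> j≰c) j< (right-c i<b b<c ≤-refl c<b)
  ... | no  j≰c | no  c≮b = right C (<-trans i<b b<c) (≰⇒> j≰c) j< (<-≤-trans lt (≮⇒≥ c≮b))

-- Only inversions of `u` across `c` need an argument. Either the left letter exceeds the one at
-- `c`, or the right letter is below it; this inversion passes to `w` on one side, and the cut
-- extends it across. Nothing is asked of `u` at `c`, so `w` is maximal.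
≼-glue : ∀ {u w c} → Cut w c → length u ≡ length w →
         take (suc c) u ≼ take (suc c) w → drop c u ≼ drop c w → u ≼ w
≼-glue {u} {w} {c} C len (_ ,≼ f) (_ ,≼ g) = len ,≼ h
  where
  c<u : c < length u
  c<u = subst (c <_) (sym len) (inside C)
  before-c : ∀ {i j} → i < j → j ≤ c → at u j < at u i → at w j < at w i
  before-c i<j j≤c lt = subst₂ _<_ (at-take (suc c) w (s≤s j≤c)) (at-take (suc c) w i<)
    (f i<j (subst (_ <_) (sym (length-take-≤ u c<u)) (s≤s j≤c))
      (subst₂ _<_ (sym (at-take (suc c) u (s≤s j≤c))) (sym (at-take (suc c) u i<)) lt))
    where i< = <-trans i<j (s≤s j≤c)
  at-d : ∀ v {i} → c ≤ i → at (drop c v) (i ∸ c) ≡ at v i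
  at-d v {i} c≤i = trans (at-drop c v (i ∸ c)) (cong (at v) (m+[n∸m]≡n c≤i))
  after-c : ∀ {i j} → c ≤ i → i < j → j < length u → at u j < at u i → at w j < at w i
  after-c {i} {j} c≤i i<j j< lt = subst₂ _<_ (at-d w c≤j) (at-d w c≤i)
    (g (∸-monoˡ-< i<j c≤i) (subst (j ∸ c <_) (sym (length-drop c u)) (∸-monoˡ-< j< c≤j))
      (subst₂ _<_ (sym (at-d u c≤j)) (sym (at-d u c≤i)) lt))
    where c≤j = ≤-trans c≤i (<⇒≤ i<j)
  h : ∀ {i j} → i < j → j < length u → at u j < at u i → at w j < at w i
  h {i} {j} i<j j< lt with j ≤? c | c ≤? i
  ... | yes j≤c | _       = before-c i<j j≤c lt
  ... | no _    | yes c≤i = after-c c≤i i<j j< lt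
  ... | no j≰c  | no c≰i with at u c <? at u i
  ...   | yes p = left C (≰⇒> c≰i) (≰⇒> j≰c) (subst (j <_) len j<) (before-c (≰⇒> c≰i) ≤-refl p)
  ...   | no ¬p = right C (≰⇒> c≰i) (≰⇒> j≰c) (subst (j <_) len j<)
                    (after-c ≤-refl (≰⇒> j≰c) j< (<-≤-trans lt (≮⇒≥ ¬p)))

-- Cuts of permutations

take-∈ : ∀ {α k i} → i < k → i < length α → at α i ∈ take k α
take-∈ {α} {k} i<k i< = subst (_∈ take k α) (at-take k α i<k)
  (at-∈ (take k α) (subst (_ <_) (sym (length-take k α)) (⊓-pres-m< i<k i<)))

take-∈⁻ : ∀ {α k x} → x ∈ take k α → ∃ λ i → i < k × i < length α × x ≡ at α i
take-∈⁻ {α} {k} x∈ with i , i< , refl ← ∈-at x∈ =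
  let i<k , i<α = <-length-take k α i< in i , i<k , i<α , at-take k α i<k

-- Letters after `c` avoid the union. An early letter above `x₀` lies in the interval reaching up to
-- `n`, so all larger letters are early too. A late letter below `x₀` lies below `a`; an early
-- letter under it would again belong to the upper interval and drag the late one in.
secable⇒cut : ∀ {α c} → IsPerm α → c < length α → SecableAt α (suc c) → Cut α c
secable⇒cut {α} {c} perm c< (a , J , a≤ , ⇔union , _) = record
  { inside = c<
  ; left   = λ {i} {j} i<c c<j j< lt → case-left i<c c<j j< lt (prefix i<c)
  ; right  = λ {i} {j} i<c c<j j< lt → case-right i<c c<j j< lt (prefix i<c) }
  where
  n = length α
  x₀ = at α c
  prefix : ∀ {i} → i < c → InUnion a x₀ J n (at α i)
  prefix i<c = Equivalence.to (⇔union _) (take-∈ {α} (<-trans i<c ≤-refl) (<-trans i<c c<))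
  suffix : ∀ {j} → c < j → j < n → ¬ InUnion a x₀ J n (at α j)
  suffix c<j j< U with i , i<c , i< , eq ← take-∈⁻ {α} (Equivalence.from (⇔union _) U) =
    unique⇒at-≢ (perm-unique perm) (<-≤-trans i<c c<j) j< (sym eq)
  bound : ∀ {j} → j < n → at α j ≤ n
  bound j< = proj₂ (perm-range perm (at-∈ α j<))
  in-I : ∀ J {x} → a ≤ x → x ≤ x₀ → InUnion a x₀ J n x
  in-I nothing  p q = p , q
  in-I (just _) p q = inj₁ (p , q)
  in-J : ∀ J {x y} → InUnion a x₀ J n x → ¬ (a ≤ x × x ≤ x₀) → x ≤ y → y ≤ n → InUnion a x₀ J n y
  in-J nothing  U              ¬I _   _   = contradiction U ¬I
  in-J (just b) (inj₁ I)       ¬I _   _   = contradiction I ¬I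
  in-J (just b) (inj₂ (b≤ , _)) _ x≤y y≤n = inj₂ (≤-trans b≤ x≤y , y≤n)
  case-left : ∀ {i j} → i < c → c < j → j < n → x₀ < at α i → InUnion a x₀ J n (at α i) → at α j < at α i
  case-left {i} {j} i<c c<j j< lt U with at α j <? at α i
  ... | yes p = p
  ... | no ¬p = contradiction (in-J J U (<⇒≱ lt ∘ proj₂) (≮⇒≥ ¬p) (bound j<)) (suffix c<j j<)
  case-right : ∀ {i j} → i < c → c < j → j < n → at α j < x₀ → InUnion a x₀ J n (at α i) → at α j < at α i
  case-right {i} {j} i<c c<j j< lt U with a ≤? at α j | at α j <? at α i | a ≤? at α i
  ... | _      | yes p | _      = p
  ... | yes a≤ | no ¬p | _      = contradiction (in-I J a≤ (<⇒≤ lt)) (suffix c<j j<)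
  ... | no a≰  | no ¬p | yes a≤ = contradiction (≤-trans a≤ (≮⇒≥ ¬p)) a≰
  ... | no _   | no ¬p | no a≰  = contradiction (in-J J U (a≰ ∘ proj₁) (≮⇒≥ ¬p) (bound j<)) (suffix c<j j<)

cut⇒secable : ∀ {α c} → IsPerm α → Cut α c → SecableAt α (suc c)
cut⇒secable {α} {c} perm C = answer
  where
  n = length α
  x₀ = at α c
  c< = inside C
  range : ∀ {i} → i < n → 1 ≤ at α i × at α i ≤ n
  range i< = perm-range perm (at-∈ α i<)
  -- The two intervals start just above the late letters: `a` follows the largest late letter below
  -- `x₀` (0 if there is none), and `b` follows the largest among `x₀` and all late letters.
  lows = filter (_<? x₀) (drop (suc c) α)
  a = suc (max 0 lows)
  b = suc (max x₀ (drop (suc c) α))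
  late-∈ : ∀ {j} → c < j → j < n → at α j ∈ drop (suc c) α
  late-∈ {j} c<j j< = subst (_∈ drop (suc c) α)
    (trans (at-drop (suc c) α (j ∸ suc c)) (cong (at α) (m+[n∸m]≡n c<j)))
    (at-∈ _ (subst (j ∸ suc c <_) (sym (length-drop (suc c) α)) (∸-monoˡ-< j< c<j)))
  late-∈⁻ : ∀ {x} → x ∈ drop (suc c) α → ∃ λ j → c < j × j < n × x ≡ at α j
  late-∈⁻ x∈ with l , l< , refl ← ∈-at x∈ =
    suc c + l , m≤m+n (suc c) l , <-length-drop (suc c) α l< , at-drop (suc c) α l
  a≤x₀ : a ≤ x₀
  a≤x₀ = max<v⁺ (proj₁ (range c<)) (All.tabulate λ x∈ → proj₂ (∈-filter⁻ (_<? x₀) {xs = drop (suc c) α} x∈))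
  low : ∀ {j} → c < j → j < n → at α j < x₀ → at α j < a
  low c<j j< lt = s≤s (All.lookup (xs≤max 0 lows) (∈-filter⁺ (_<? x₀) (late-∈ c<j j<) lt))
  high : ∀ {j} → c < j → j < n → at α j < b
  high c<j j< = s≤s (All.lookup (xs≤max x₀ (drop (suc c) α)) (late-∈ c<j j<))
  early : ∀ {x} → 1 ≤ x → x ≤ n → (∀ {j} → c < j → j < n → x ≢ at α j) → x ∈ take (suc c) α
  early 1≤ ≤n not-late with i , i< , refl ← perm-at perm 1≤ ≤n with i ≤? c
  ... | yes i≤c = take-∈ {α} (s≤s i≤c) i<
  ... | no  i≰c = contradiction refl (not-late (≰⇒> i≰c) i<)
  from-I : ∀ {x} → a ≤ x → x ≤ x₀ → x ∈ take (suc c) α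
  from-I a≤x x≤ = early (≤-trans z<s a≤x) (≤-trans x≤ (proj₂ (range c<))) λ
    { {j} c<j j< refl → <⇒≱ (low c<j j< (≤∧≢⇒< x≤ (≢-sym (unique⇒at-≢ (perm-unique perm) c<j j<)))) a≤x }
  from-J : ∀ {x} → b ≤ x → x ≤ n → x ∈ take (suc c) α
  from-J b≤x x≤ = early (≤-trans z<s b≤x) x≤ λ { c<j j< refl → <⇒≱ (high c<j j<) b≤x }
  to-union : ∀ {x} → x ∈ take (suc c) α → (a ≤ x × x ≤ x₀) ⊎ (b ≤ x × x ≤ n)
  to-union x∈ with i , i<c , i< , refl ← take-∈⁻ {α} x∈ with <-cmp (at α i) x₀
  ... | tri≈ _ eq _ = inj₁ (subst (a ≤_) (sym eq) a≤x₀ , ≤-reflexive eq)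
  ... | tri< lt _ _ = inj₁ (max<v⁺ (proj₁ (range i<)) (All.tabulate late-low) , <⇒≤ lt)
    where
    i<c′ = ≤∧≢⇒< (s≤s⁻¹ i<c) λ { refl → <-irrefl refl lt }
    late-low : ∀ {y} → y ∈ lows → y < at α i
    late-low y∈ with y∈′ , y<x₀ ← ∈-filter⁻ (_<? x₀) {xs = drop (suc c) α} y∈
                with j , c<j , j< , refl ← late-∈⁻ y∈′ = right C i<c′ c<j j< y<x₀
  ... | tri> _ _ gt = inj₂ (max<v⁺ gt (All.tabulate late-low) , proj₂ (range i<))
    where
    i<c′ = ≤∧≢⇒< (s≤s⁻¹ i<c) λ { refl → <-irrefl refl gt }
    late-low : ∀ {y} → y ∈ drop (suc c) α → y < at α i
    late-low y∈ with j , c<j , j< , refl ← late-∈⁻ y∈ = left C i<c′ c<j j< gt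
  answer : SecableAt α (suc c)
  -- When `b` exceeds `n`, the upper interval is empty and has to be encoded by `nothing`.
  answer with b ≤? n
  ... | yes b≤n = a , just b , a≤x₀
                , (λ x → mk⇔ to-union [ (λ (p , q) → from-I p q) , (λ (p , q) → from-J p q) ]′)
                , λ { _ refl → b≤n }
  ... | no  b≰n = a , nothing , a≤x₀
                , (λ x → mk⇔ ([ id , (λ (p , q) → contradiction (≤-trans p q) b≰n) ]′ ∘ to-union) (λ (p , q) → from-I p q))
                , λ _ ()

-- Secability is tested at a prefix length k, a cut at the zero-based position b = k - 1; for length
-- `suc c` the range 2 ≤ k < n becomes 1 ≤ b < c.
nonSecable⁺ : ∀ {α c} → IsPerm α → length α ≡ suc c → 1 ≤ c → (∀ {b} → 1 ≤ b → b < c → ¬ Cut α b) → NonSecable α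
nonSecable⁺ perm len 1≤c no-cut = perm , subst (2 ≤_) (sym len) (s≤s 1≤c) , λ
  { (suc b) (s≤s 1≤b) b< sec → no-cut 1≤b (s≤s⁻¹ (subst (_ <_) len b<)) (secable⇒cut perm (<-trans ≤-refl b<) sec) }

nonSecable⁻ : ∀ {α c} → NonSecable α → length α ≡ suc c → ∀ {b} → 1 ≤ b → b < c → ¬ Cut α b
nonSecable⁻ (perm , _ , f) len {b} 1≤b b<c C = f (suc b) (s≤s 1≤b) (subst (suc b <_) (sym len) (s≤s b<c)) (cut⇒secable perm C)

-- Factorizations

-- Consecutive blocks share the letter at `c`, as in the product. The last block ends at the final
-- position, always a cut, and leaves one letter, which corresponds to the empty monomial.
data Factorization : List (List ℕ) → Word → Set where
  letter : ∀ {w} → length w ≡ 1 → Factorization [] w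
  block  : ∀ {α m w} c → NonSecable α → std (take (suc c) w) ≡ α → Cut w c →
           Factorization m (drop c w) → Factorization (α ∷ m) w

factorization-nonSecable : ∀ {m w} → Factorization m w → All NonSecable m
factorization-nonSecable (letter _)       = []
factorization-nonSecable (block _ ns _ _ F) = ns ∷ factorization-nonSecable F

block-length : ∀ {w c} → c < length w → length (std (take (suc c) w)) ≡ suc c
block-length {w} {c} c< = trans (length-std (take (suc c) w)) (length-take-≤ w c<)

factorization-resp : ∀ {m u w} → u ≈ʷ w → Factorization m u → Factorization m w
factorization-resp u≈w (letter len) = letter (trans (sym (same-length (proj₁ u≈w))) len)
factorization-resp u≈w (block c ns eq C F) =
  block c ns (trans (sym (std-cong (≈ʷ-take (suc c) u≈w))) eq) (cut-resp u≈w C)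
    (factorization-resp (≈ʷ-drop c u≈w) F)

-- A cut strictly inside the block would survive in the prefix and its standardization, against
-- non-secability. So the first block must end at the first cut after position 0, which makes
-- factorizations unique.
first-cut-≤ : ∀ {w b c} → NonSecable (std (take (suc c) w)) → 1 ≤ b → Cut w b → Cut w c → c ≤ b
first-cut-≤ {w} {b} {c} ns 1≤b B C with c ≤? b
... | yes p = p
... | no  p = contradiction (cut-resp (std-≈ʷ _) (cut-take (suc c) (<-trans (≰⇒> p) ≤-refl) B))
                (nonSecable⁻ ns (block-length {w} (inside C)) 1≤b (≰⇒> p))

block-position : ∀ {w c} → NonSecable (std (take (suc c) w)) → Cut w c → 1 ≤ c
block-position {w} (_ , 2≤ , _) C = s≤s⁻¹ (subst (2 ≤_) (block-length {w} (inside C)) 2≤)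

factorization-unique : ∀ {m m′ w} → Factorization m w → Factorization m′ w → m ≡ m′
factorization-unique (letter _) (letter _) = refl
factorization-unique (letter len) (block c ns refl C _) =
  contradiction (subst (c <_) len (inside C)) (≤⇒≯ (block-position ns C))
factorization-unique (block c ns refl C _) (letter len) =
  contradiction (subst (c <_) len (inside C)) (≤⇒≯ (block-position ns C))
factorization-unique (block c ns refl C F) (block c′ ns′ refl C′ F′)
  with refl ← ≤-antisym (first-cut-≤ ns (block-position ns′ C′) C′ C)
                        (first-cut-≤ ns′ (block-position ns C) C C′) =
  cong (_ ∷_) (factorization-unique F F′)

first-cut : ∀ {w} c → 1 ≤ c → Cut w c → ∃ λ b → 1 ≤ b × Cut w b × (∀ {a} → 1 ≤ a → a < b → ¬ Cut w a)
first-cut {w} c 1≤c C = search c 1≤c C (<-wellFounded c)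
  where
  search : ∀ c → 1 ≤ c → Cut w c → Acc _<_ c → ∃ λ b → 1 ≤ b × Cut w b × (∀ {a} → 1 ≤ a → a < b → ¬ Cut w a)
  search c 1≤c C (acc rec) with anyUpTo? (λ a → (1 ≤? a) ×-dec cut? w a) c
  ... | yes (a , a<c , 1≤a , A) = search a 1≤a A (rec a<c)
  ... | no  none = c , 1≤c , C , λ 1≤a a<c A → none (_ , a<c , 1≤a , A)

-- Chop at the first cut after position 0, which exists because the last position is a cut.
-- Leastness and `cut-untake` make the block non-secable, and at least one letter is dropped.
factorize : ∀ w → 1 ≤ length w → ∃ λ m → Factorization m w
factorize w = go (length w) w ≤-refl
  where
  go : ∀ N w → length w ≤ N → 1 ≤ length w → ∃ λ m → Factorization m w
  go zero    w len≤ 1≤ = contradiction (≤-trans 1≤ len≤) λ ()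
  go (suc N) w len≤ 1≤ with length w in len
  go (suc N) w len≤ 1≤ | suc zero = [] , letter len
  go (suc N) w len≤ 1≤ | suc (suc n) with c , 1≤c , C , least ← first-cut (suc n) z<s (cut-last len) =
    let rest≤ = subst (_≤ N) (sym (length-drop c w)) (≤-trans (∸-monoʳ-≤ (length w) 1≤c) (subst (λ l → l ∸ 1 ≤ N) (sym len) (s≤s⁻¹ len≤)))
        rest≥ = subst (1 ≤_) (sym (length-drop c w)) (m<n⇒0<n∸m (inside C))
        m , F = go N (drop c w) rest≤ rest≥
        t = take (suc c) w
        ns = nonSecable⁺ (isPerm-std t) (block-length {w} (inside C)) 1≤c λ 1≤b b<c B →
               least 1≤b b<c (cut-untake b<c C (cut-resp (≈ʷ-sym (std-≈ʷ t)) B))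
    in std t ∷ m , block c ns refl C F

-- Gluing words along a common letter

map-≈ʷ : ∀ f w → (∀ {x y} → x < y → f x < f y) → w ≈ʷ map f w
map-≈ʷ f w f-mono =
    (sym (length-map f w) ,≼ λ i<j j< lt →
      subst₂ _<_ (sym (at-map f w j<)) (sym (at-map f w (<-trans i<j j<))) (f-mono lt))
  , (length-map f w ,≼ λ i<j j<m lt → let j< = subst (_ <_) (length-map f w) j<m in
      f-cancel (subst₂ _<_ (at-map f w j<) (at-map f w (<-trans i<j j<)) lt))
  where
  f-cancel : ∀ {x y} → f x < f y → x < y
  f-cancel {x} {y} lt with <-cmp x y
  ... | tri< p _ _    = p
  ... | tri≈ _ refl _ = contradiction lt (<-irrefl refl)
  ... | tri> _ _ p    = contradiction lt (<-asym (f-mono p))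

at-++ˡ : ∀ xs ys {i} → i < length xs → at (xs ++ ys) i ≡ at xs i
at-++ˡ (x ∷ xs) ys {zero}  _        = refl
at-++ˡ (x ∷ xs) ys {suc i} (s≤s i<) = at-++ˡ xs ys i<

take-++ : ∀ {k} (xs ys : Word) → length xs ≡ k → take k (xs ++ ys) ≡ xs
take-++ []       ys refl = refl
take-++ (x ∷ xs) ys refl = cong (x ∷_) (take-++ xs ys refl)

drop-++-last : ∀ {c} xs ys → length xs ≡ suc c → drop c (xs ++ ys) ≡ at xs c ∷ ys
drop-++-last {zero}  (x ∷ [])     ys refl = refl
drop-++-last {suc c} (x ∷ xs)     ys eq   = drop-++-last xs ys (suc-injective eq)

at≤sum : ∀ w i → at w i ≤ sum w
at≤sum []      i       = z≤n
at≤sum (x ∷ w) zero    = m≤m+n x (sum w)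
at≤sum (x ∷ w) (suc i) = ≤-trans (at≤sum w i) (m≤n+m (sum w) x)

-- The glued word agrees up to ≈ʷ with α up to position c and with y ∷ v from c on; the order of
-- its values is  {v < y}  <  {α ≤ x}  <  {v > y}  <  {α > x},  where x is the last letter of α.
module Glue (α : Word) (c : ℕ) (len : length α ≡ suc c) (y : ℕ) (v : Word) where
  x = at α c
  -- The sum serves as an upper bound for every letter of `y ∷ v`; it lifts the letters of `α` above
  -- `x` over all of `ψ`'s values on that word.
  s = sum (y ∷ v)

  φ : ℕ → ℕ
  φ z with z ≤? x
  ... | yes _ = z + y
  ... | no  _ = z + (x + s)

  ψ : ℕ → ℕ
  ψ z with z <? y
  ... | yes _ = z
  ... | no  _ = z + x

  φ-low : ∀ {z} → z ≤ x → φ z ≡ z + y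
  φ-low {z} z≤ with z ≤? x
  ... | yes _ = refl
  ... | no  p = contradiction z≤ p

  φ-high : ∀ {z} → x < z → φ z ≡ z + (x + s)
  φ-high {z} <z with z ≤? x
  ... | yes p = contradiction <z (≤⇒≯ p)
  ... | no  _ = refl

  ψ-low : ∀ {z} → z < y → ψ z ≡ z
  ψ-low {z} z< with z <? y
  ... | yes _ = refl
  ... | no  p = contradiction z< p

  ψ-high : ∀ {z} → y ≤ z → ψ z ≡ z + x
  ψ-high {z} ≤z with z <? y
  ... | yes p = contradiction p (≤⇒≯ ≤z)
  ... | no  _ = refl

  φ-mono : ∀ {z z′} → z < z′ → φ z < φ z′
  φ-mono {z} {z′} lt with z ≤? x | z′ ≤? x
  ... | yes _ | yes _ = +-monoˡ-< y lt
  ... | yes _ | no  _ = +-mono-<-≤ lt (≤-trans (m≤m+n y (sum v)) (m≤n+m s x))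
  ... | no  p | yes q = contradiction (≤-trans (<⇒≤ lt) q) p
  ... | no  _ | no  _ = +-monoˡ-< (x + s) lt

  ψ-mono : ∀ {z z′} → z < z′ → ψ z < ψ z′
  ψ-mono {z} {z′} lt with z <? y | z′ <? y
  ... | yes _ | yes _ = lt
  ... | yes _ | no  _ = <-≤-trans lt (m≤m+n z′ x)
  ... | no  p | yes q = contradiction (<-trans lt q) p
  ... | no  _ | no  _ = +-monoˡ-< x lt

  ψ-≤ : ∀ z → ψ z ≤ z + x
  ψ-≤ z with z <? y
  ... | yes _ = m≤m+n z x
  ... | no  _ = ≤-refl

  φx≡ψy : φ x ≡ ψ y
  φx≡ψy = trans (φ-low ≤-refl) (trans (+-comm x y) (sym (ψ-high ≤-refl)))

  glued : Word
  glued = map φ α ++ map ψ v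

  len-φ : length (map φ α) ≡ suc c
  len-φ = trans (length-map φ α) len

  take-glued : take (suc c) glued ≡ map φ α
  take-glued = take-++ (map φ α) (map ψ v) len-φ

  drop-glued : drop c glued ≡ map ψ (y ∷ v)
  drop-glued = trans (drop-++-last (map φ α) (map ψ v) len-φ)
    (cong (_∷ map ψ v) (trans (at-map φ α (≤-reflexive (sym len))) φx≡ψy))

  at-early : ∀ {i} → i ≤ c → at glued i ≡ φ (at α i)
  at-early {i} i≤c = trans (at-++ˡ (map φ α) (map ψ v) (≤-trans (s≤s i≤c) (≤-reflexive (sym len-φ))))
    (at-map φ α (≤-trans (s≤s i≤c) (≤-reflexive (sym len))))

  at-late : ∀ {j} → c ≤ j → j < length glued → at glued j ≡ ψ (at (y ∷ v) (j ∸ c))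
  at-late {j} c≤j j< = begin
    at glued j                   ≡⟨ cong (at glued) (m+[n∸m]≡n c≤j) ⟨
    at glued (c + (j ∸ c))       ≡⟨ at-drop c glued (j ∸ c) ⟨
    at (drop c glued) (j ∸ c)    ≡⟨ cong (λ w → at w (j ∸ c)) drop-glued ⟩
    at (map ψ (y ∷ v)) (j ∸ c)   ≡⟨ at-map ψ (y ∷ v) j∸c< ⟩
    ψ (at (y ∷ v) (j ∸ c))       ∎
    where
    open ≡-Reasoning
    j∸c< : j ∸ c < length (y ∷ v)
    j∸c< = subst (j ∸ c <_) (trans (sym (length-drop c glued)) (trans (cong length drop-glued) (length-map ψ (y ∷ v))))
             (∸-monoˡ-< j< c≤j)

  -- Letters of `α` above `x` end up above everything on the right, and letters of `v` below `y` end
  -- up below everything on the left.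
  cut-glued : Cut glued c
  cut-glued = record
    { inside = subst (c <_) (sym (length-++ (map φ α))) (≤-trans (≤-reflexive (sym len-φ)) (m≤m+n _ _))
    ; left   = λ {i} {j} i<c c<j j< lt →
        let x<αi = φ-cancel (subst₂ _<_ (at-early ≤-refl) (at-early (<⇒≤ i<c)) lt) in
        subst₂ _<_ (sym (at-late (<⇒≤ c<j) j<)) (sym (trans (at-early (<⇒≤ i<c)) (φ-high x<αi)))
          (high (at α i) x<αi (j ∸ c))
    ; right  = λ {i} {j} i<c c<j j< lt →
        let z<y = ψ-cancel (subst₂ _<_ (at-late (<⇒≤ c<j) j<) (trans (at-early ≤-refl) φx≡ψy) lt) in
        subst₂ _<_ (sym (trans (at-late (<⇒≤ c<j) j<) (ψ-low z<y))) (sym (at-early (<⇒≤ i<c)))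
          (<-≤-trans z<y (φ-≥ (at α i))) }
    where
    φ-cancel : ∀ {z} → φ x < φ z → x < z
    φ-cancel {z} lt with <-cmp x z
    ... | tri< p _ _    = p
    ... | tri≈ _ refl _ = contradiction lt (<-irrefl refl)
    ... | tri> _ _ p    = contradiction lt (<-asym (φ-mono p))
    ψ-cancel : ∀ {z} → ψ z < ψ y → z < y
    ψ-cancel {z} lt with <-cmp z y
    ... | tri< p _ _    = p
    ... | tri≈ _ refl _ = contradiction lt (<-irrefl refl)
    ... | tri> _ _ p    = contradiction lt (<-asym (ψ-mono p))
    φ-≥ : ∀ z → y ≤ φ z
    φ-≥ z with z ≤? x
    ... | yes _ = m≤n+m y z
    ... | no  _ = ≤-trans (≤-trans (m≤m+n y (sum v)) (m≤n+m s x)) (m≤n+m (x + s) z)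
    high : ∀ z → x < z → ∀ l → ψ (at (y ∷ v) l) < z + (x + s)
    high z x<z l = ≤-<-trans (ψ-≤ _) (≤-<-trans (+-monoˡ-≤ x (at≤sum (y ∷ v) l))
      (subst (_< z + (x + s)) (+-comm x s) (m<n+m (x + s) (≤-trans z<s x<z))))

-- Blocks are glued on from right to left, starting from an arbitrary letter. Every monomial thereby
-- gets a leading word.
realize : ∀ m → All NonSecable m → ∃ λ w → Factorization m w
realize []      []        = 0 ∷ [] , letter refl
realize ([] ∷ m) ((_ , () , _) ∷ _)
realize (α@(a ∷ α′) ∷ m) (ns ∷ nss) with realize m nss
... | [] , letter ()
... | [] , block c _ _ C _ = contradiction (inside C) λ ()
... | y ∷ v , F = glued , block (length α′) ns
    (trans (cong std take-glued) (trans (sym (std-cong (map-≈ʷ φ α φ-mono))) (std-perm (proj₁ ns))))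
    cut-glued
    (subst (Factorization m) (sym drop-glued) (factorization-resp (map-≈ʷ ψ (y ∷ v) ψ-mono) F))
  where open Glue α (length α′) refl y v

-- Lists of permutations

words : ℕ → List ℕ → List Word
words zero    L = [] ∷ []
words (suc n) L = cartesianProductWith _∷_ L (words n L)

words-length : ∀ n {L w} → w ∈ words n L → length w ≡ n
words-length zero    (here refl) = refl
words-length (suc n) {L} w∈ with _ , _ , _ , v∈ , refl ← ∈-cartesianProductWith⁻ _∷_ L (words n L) w∈ =
  cong suc (words-length n v∈)

words-complete : ∀ {L w} → (∀ {x} → x ∈ w → x ∈ L) → w ∈ words (length w) L
words-complete {w = []}    _ = here refl
words-complete {w = x ∷ w} f = ∈-cartesianProductWith⁺ _∷_ (f (here refl)) (words-complete (f ∘ there))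

-- Different words may share a standardization; duplicates are removed because coefficient
-- extraction in `lincomb-single` requires distinct indices.
permutations : ℕ → List (List ℕ)
permutations n = deduplicate (≡-dec _≟_) (map std (words n (map suc (upTo n))))

permutations-unique : ∀ n → Unique (permutations n)
permutations-unique n = deduplicate-! (map std (words n (map suc (upTo n))))

∈-permutations⁻ : ∀ {n τ} → τ ∈ permutations n → IsPerm τ × length τ ≡ n
∈-permutations⁻ {n} τ∈
  with u , u∈ , refl ← ∈-map⁻ std (∈-deduplicate⁻ (≡-dec _≟_) (map std (words n (map suc (upTo n)))) τ∈) =
  isPerm-std u , trans (length-std u) (words-length n u∈)

std-∈-permutations : ∀ w → std w ∈ permutations (length w)
std-∈-permutations w = ∈-deduplicate⁺ (≡-dec _≟_) (subst (_∈ map std (words n (map suc (upTo n)))) (std-idem w)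
  (∈-map⁺ std (subst (λ k → std w ∈ words k (map suc (upTo n))) (length-std w)
    (words-complete (subst (λ k → _ ∈ map suc (upTo k)) (length-std w) ∘ ∈-resp-↭ (isPerm-std w))))))
  where n = length w

module _ {c ℓ : Level} (K : Field c ℓ) where
  private module K = Field K
  open Field K using (Carrier; _≈_; 0#; 1#) renaming (_+_ to _⊕_; _*_ to _⊗_; -_ to ⊖_)
  open FQSymDefs K
  open import Relation.Binary.Reasoning.Setoid K.setoid

  -- Finite sums

  sumL-zero : ∀ n {f : ℕ → Carrier} → (∀ {i} → i < n → f i ≈ 0#) → sumL (applyUpTo f n) ≈ 0#
  sumL-zero zero    _  = K.refl
  sumL-zero (suc n) f0 = K.trans (K.+-cong (f0 z<s) (sumL-zero n (f0 ∘ s<s))) (K.+-identityˡ 0#)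

  sumL-single : ∀ n {f : ℕ → Carrier} {k} → k < n → (∀ {i} → i < n → i ≢ k → f i ≈ 0#) →
                sumL (applyUpTo f n) ≈ f k
  sumL-single (suc n) {k = zero}  _         f0 =
    K.trans (K.+-congˡ (sumL-zero n (λ i< → f0 (s<s i<) λ ()))) (K.+-identityʳ _)
  sumL-single (suc n) {k = suc k} (s≤s k<n) f0 =
    K.trans (K.+-cong (f0 z<s λ ()) (sumL-single n k<n (λ i< i≢ → f0 (s<s i<) (i≢ ∘ suc-injective)))) (K.+-identityˡ _)

  module _ {X : Set} (e : X → Series) where

    lincomb-zero : ∀ l w → (∀ {a x} → (a , x) ∈ l → a ⊗ e x w ≈ 0#) → lincomb e l w ≈ 0#
    lincomb-zero []            w _  = K.refl
    lincomb-zero ((a , x) ∷ l) w f0 =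
      K.trans (K.+-cong (f0 (here refl)) (lincomb-zero l w (f0 ∘ there))) (K.+-identityˡ 0#)

    lincomb-single : ∀ l w → Unique (map proj₂ l) → ∀ {a x} → (a , x) ∈ l →
                     (∀ {b y} → (b , y) ∈ l → y ≢ x → b ⊗ e y w ≈ 0#) → lincomb e l w ≈ a ⊗ e x w
    lincomb-single (_ ∷ l) w (x∉ ∷ _) (here refl) f0 = K.trans
      (K.+-congˡ (lincomb-zero l w λ p∈ → f0 (there p∈) (≢-sym (All.lookup x∉ (∈-map⁺ proj₂ p∈)))))
      (K.+-identityʳ _)
    lincomb-single (_ ∷ l) w (x∉ ∷ u) (there p∈) f0 = K.trans
      (K.+-cong (f0 (here refl) (All.lookup x∉ (∈-map⁺ proj₂ p∈))) (lincomb-single l w u p∈ (f0 ∘ there)))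
      (K.+-identityˡ _)

    lincomb-++ : ∀ l l′ w → lincomb e (l ++ l′) w ≈ lincomb e l w ⊕ lincomb e l′ w
    lincomb-++ []            l′ w = K.sym (K.+-identityˡ _)
    lincomb-++ ((a , x) ∷ l) l′ w = K.trans (K.+-congˡ (lincomb-++ l l′ w)) (K.sym (K.+-assoc _ _ _))

    scale : Carrier → List (Carrier × X) → List (Carrier × X)
    scale b = map λ (a , x) → b ⊗ a , x

    lincomb-scale : ∀ b l w → lincomb e (scale b l) w ≈ b ⊗ lincomb e l w
    lincomb-scale b []            w = K.sym (K.zeroʳ b)
    lincomb-scale b ((a , x) ∷ l) w =
      K.trans (K.+-cong (K.*-assoc b a _) (lincomb-scale b l w)) (K.sym (K.distribˡ b _ _))

    module _ {P : X → Set} where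

      span-cong : ∀ {f g} → (∀ w → g w ≈ f w) → InSpan P e f → InSpan P e g
      span-cong g≈f (l , Pl , f≈) = l , Pl , λ w → K.trans (g≈f w) (f≈ w)

      span-generator : ∀ {x} → P x → InSpan P e (e x)
      span-generator {x} Px = (1# , x) ∷ [] , Px ∷ [] , λ w →
        K.sym (K.trans (K.+-identityʳ _) (K.*-identityˡ _))

      span-+ : ∀ {f g} → InSpan P e f → InSpan P e g → InSpan P e (λ w → f w ⊕ g w)
      span-+ (l , Pl , f≈) (l′ , Pl′ , g≈) = l ++ l′ , All.++⁺ Pl Pl′ , λ w →
        K.trans (K.+-cong (f≈ w) (g≈ w)) (K.sym (lincomb-++ l l′ w))

      span-scale : ∀ b {f} → InSpan P e f → InSpan P e (λ w → b ⊗ f w)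
      span-scale b (l , Pl , f≈) = scale b l , All.map⁺ Pl , λ w →
        K.trans (K.*-congˡ (f≈ w)) (K.sym (lincomb-scale b l w))

      -- The alternative `a ≈ 0#` lets a combination run over all permutations of a given size
      -- although only some of their `G τ` are yet known to lie in the span.
      span-lincomb : {Y : Set} (d : Y → Series) → ∀ l →
                     (∀ {a y} → (a , y) ∈ l → a ≈ 0# ⊎ InSpan P e (d y)) → InSpan P e (lincomb d l)
      span-lincomb d []            _ = [] , [] , λ _ → K.refl
      span-lincomb d ((a , y) ∷ l) h with h (here refl) | span-lincomb d l (h ∘ there)
      ... | inj₂ dy  | rest = span-+ (span-scale a dy) rest
      ... | inj₁ a≈0 | rest = span-cong (λ w → K.trans (K.+-congʳ (K.trans (K.*-congʳ a≈0) (K.zeroˡ _))) (K.+-identityˡ _)) rest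

  -- Expansion in the basis G

  -- Equality in the field is not assumed decidable, so the value of a coefficient is kept together
  -- with a decision of the property it indicates.
  Indicator : Set → Carrier → Set ℓ
  Indicator P x = (P × x ≈ 1#) ⊎ (¬ P × x ≈ 0#)

  indicator-true : ∀ {P x} → Indicator P x → P → x ≈ 1#
  indicator-true (inj₁ (_ , x≈1)) _ = x≈1
  indicator-true (inj₂ (¬p , _))  p = contradiction p ¬p

  indicator-false : ∀ {P x} → Indicator P x → ¬ P → x ≈ 0#
  indicator-false (inj₁ (p , _))   ¬p = contradiction p ¬p
  indicator-false (inj₂ (_ , x≈0)) _  = x≈0

  indicator-⇔ : ∀ {P Q x y} → (P → Q) → (Q → P) → Indicator P x → Indicator Q y → x ≈ y
  indicator-⇔ f g (inj₁ (p , x≈1))  I = K.trans x≈1 (K.sym (indicator-true I (f p)))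
  indicator-⇔ f g (inj₂ (¬p , x≈0)) I = K.trans x≈0 (K.sym (indicator-false I (¬p ∘ g)))

  G-indicator : ∀ σ w → Indicator (std w ≡ σ) (G σ w)
  G-indicator σ w with ≡-dec _≟_ (std w) σ
  ... | yes p = inj₁ (p , K.refl)
  ... | no ¬p = inj₂ (¬p , K.refl)

  S-indicator : ∀ σ w → Indicator (w ≼ σ) (S σ w)
  S-indicator σ w with weakLeᵇ (std w) σ in eq
  ... | true  = inj₁ (≼-trans (proj₁ (std-≈ʷ w)) (weakLeᵇ⁻ (subst T (sym eq) _)) , K.refl)
  ... | false = inj₂ ((λ p → subst T eq (weakLeᵇ⁺ (≼-trans (proj₂ (std-≈ʷ w)) p))) , K.refl)

  coordinates : Series → ℕ → List (Carrier × List ℕ)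
  coordinates f n = map (λ τ → f τ , τ) (permutations n)

  ∈-coordinates : ∀ {f n a τ} → (a , τ) ∈ coordinates f n → a ≡ f τ × τ ∈ permutations n
  ∈-coordinates p∈ with _ , τ∈ , refl ← ∈-map⁻ _ p∈ = refl , τ∈

  -- A series that depends only on the standardization and lives in one degree is a finite
  -- combination: at `w` the only surviving term is that of `std w`.
  G-expansion : ∀ f n → (∀ w → f w ≈ f (std w)) → (∀ w → length w ≢ n → f w ≈ 0#) →
                ∀ w → f w ≈ lincomb G (coordinates f n) w
  G-expansion f n f-std f-supp w with length w ≟ n
  ... | yes refl = begin
    f w                                ≈⟨ f-std w ⟩
    f (std w)                          ≈⟨ K.*-identityʳ _ ⟨
    f (std w) ⊗ 1#                     ≈⟨ K.*-congˡ (indicator-true (G-indicator (std w) w) refl) ⟨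
    f (std w) ⊗ G (std w) w            ≈⟨ lincomb-single G (coordinates f n) w unique (∈-map⁺ _ (std-∈-permutations w)) others ⟨
    lincomb G (coordinates f n) w      ∎
    where
    unique : Unique (map proj₂ (coordinates f n))
    unique = subst Unique (trans (sym (map-id _)) (map-∘ (permutations n))) (permutations-unique n)
    others : ∀ {b τ} → (b , τ) ∈ coordinates f n → τ ≢ std w → b ⊗ G τ w ≈ 0#
    others {b} {τ} _ τ≢ = K.trans (K.*-congˡ (indicator-false (G-indicator τ w) (τ≢ ∘ sym))) (K.zeroʳ b)
  ... | no len≢ = K.trans (f-supp w len≢) (K.sym (lincomb-zero G (coordinates f n) w vanish))
    where
    vanish : ∀ {b τ} → (b , τ) ∈ coordinates f n → b ⊗ G τ w ≈ 0#
    vanish {b} {τ} p∈ = K.trans (K.*-congˡ (indicator-false (G-indicator τ w) λ { refl →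
      len≢ (trans (sym (length-std w)) (proj₂ (∈-permutations⁻ {n} (proj₂ (∈-coordinates {f} {n} p∈))))) })) (K.zeroʳ b)

  -- Triangularity

  -- Common abstraction of G and S: gen α is the sum of the words related to α by R.
  record Triangular (gen : List ℕ → Series) (R : List ℕ → Word → Set) : Set ℓ where
    field
      indicator : ∀ α u → Indicator (R α u) (gen α u)
      R⇒≼       : ∀ {α u} → R α u → u ≼ α
      R-resp    : ∀ {α u w} → u ≈ʷ w → R α u → R α w
      R-std     : ∀ u → R (std u) u

  G-triangular : Triangular G (λ α u → std u ≡ α)
  G-triangular = record
    { indicator = G-indicator
    ; R⇒≼       = λ { {u = u} refl → proj₁ (std-≈ʷ u) }
    ; R-resp    = λ u≈w eq → trans (sym (std-cong u≈w)) eq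
    ; R-std     = λ _ → refl }

  S-triangular : Triangular S (λ α u → u ≼ α)
  S-triangular = record
    { indicator = S-indicator
    ; R⇒≼       = id
    ; R-resp    = λ (_ , w≼u) → ≼-trans w≼u
    ; R-std     = λ u → proj₁ (std-≈ʷ u) }

  -- Monomials in the generators

  module _ {gen R} (tri : Triangular gen R) where
    open Triangular tri

    -- The generator `gen α` vanishes on words whose length differs from that of `α`, so at most one
    -- splitting of `w` contributes to the product.
    evalMon-∷ : ∀ {α} c m w → length α ≡ suc c →
                evalMon gen (α ∷ m) w ≈ gen α (take (suc c) w) ⊗ evalMon gen m (drop c w)
    evalMon-∷ {α} c m w len = begin
      evalMon gen (α ∷ m) w                ≡⟨ cong sumL (trans (cong (map _) (map-upTo suc (length w))) (map-applyUpTo suc _ (length w))) ⟩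
      sumL (applyUpTo term (length w))     ≈⟨ only-c ⟩
      term c                               ∎
      where
      term : ℕ → Carrier
      term i = gen α (take (suc i) w) ⊗ evalMon gen m (drop i w)
      gen-zero : ∀ {u} → length u ≢ suc c → gen α u ≈ 0#
      gen-zero len≢ = indicator-false (indicator α _) λ r → len≢ (trans (same-length (R⇒≼ r)) len)
      term-zero : ∀ {i} → length (take (suc i) w) ≢ suc c → term i ≈ 0#
      term-zero len≢ = K.trans (K.*-congʳ (gen-zero len≢)) (K.zeroˡ _)
      vanish : ∀ {i} → i < length w → i ≢ c → term i ≈ 0#
      vanish i< i≢c = term-zero λ eq → i≢c (suc-injective (trans (sym (length-take-≤ w i<)) eq))
      only-c : sumL (applyUpTo term (length w)) ≈ term c
      only-c with c <? length w
      ... | yes c< = sumL-single (length w) c< vanish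
      -- Here `w` has no position `c`: the truncated prefix is too short for `α`, and both sides are
      -- zero.
      ... | no  c≮ = K.trans (sumL-zero (length w) λ i< → vanish i< λ { refl → c≮ i< })
        (K.sym (term-zero λ eq → c≮ (proj₂ (<-length-take (suc c) w (≤-reflexive (sym eq))))))

    -- The support of the monomial. Unlike `Factorization`, it does not ask the shared letters to be
    -- cuts, so words of several standardizations may satisfy it.
    Occurs : List (List ℕ) → Word → Set
    Occurs []      w = length w ≡ 1
    Occurs (α ∷ m) w = R α (take (length α) w) × Occurs m (drop (length α ∸ 1) w)

    occurs-resp : ∀ m {u w} → u ≈ʷ w → Occurs m u → Occurs m w
    occurs-resp []      (p , _) len     = trans (sym (same-length p)) len
    occurs-resp (α ∷ m) u≈w     (r , o) =
      R-resp (≈ʷ-take (length α) u≈w) r , occurs-resp m (≈ʷ-drop (length α ∸ 1) u≈w) o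

    evalMon-indicator : ∀ {m} → All NonSecable m → ∀ w → Indicator (Occurs m w) (evalMon gen m w)
    evalMon-indicator [] w with G-indicator (1 ∷ []) w
    ... | inj₁ (eq , x≈1)  = inj₁ (trans (sym (length-std w)) (cong length eq) , x≈1)
    ... | inj₂ (¬eq , x≈0) = inj₂ (¬eq ∘ std-letter w , x≈0)
      where
      std-letter : ∀ w → length w ≡ 1 → std w ≡ 1 ∷ []
      std-letter w len = std-cong {w} {1 ∷ []}
        ( (len ,≼ λ i<j j< → contradiction (≤-trans i<j (s≤s⁻¹ (subst (_ <_) len j<))) λ ())
        , (sym len ,≼ λ i<j j< → contradiction (≤-trans i<j (s≤s⁻¹ j<)) λ ()) )
    evalMon-indicator {[] ∷ m}          ((_ , () , _) ∷ _)
    evalMon-indicator {α@(_ ∷ α′) ∷ m} (_ ∷ nss) w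
      with indicator α (take (length α) w) | evalMon-indicator nss (drop (length α′) w) | evalMon-∷ (length α′) m w refl
    ... | inj₁ (r , x≈1) | inj₁ (o , y≈1) | eq = inj₁ ((r , o) , K.trans eq (K.trans (K.*-cong x≈1 y≈1) (K.*-identityˡ 1#)))
    ... | inj₂ (¬r , x≈0) | _ | eq = inj₂ (¬r ∘ proj₁ , K.trans eq (K.trans (K.*-congʳ x≈0) (K.zeroˡ _)))
    ... | inj₁ _ | inj₂ (¬o , y≈0) | eq = inj₂ (¬o ∘ proj₂ , K.trans eq (K.trans (K.*-congˡ y≈0) (K.zeroʳ _)))

    factorization⇒occurs : ∀ {m w} → Factorization m w → Occurs m w
    factorization⇒occurs (letter len) = len
    factorization⇒occurs {w = w} (block c ns refl C F) rewrite block-length {w} (inside C) =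
      R-std (take (suc c) w) , factorization⇒occurs F

    factorization-1≤ : ∀ {m w} → Factorization m w → 1 ≤ length w
    factorization-1≤ (letter len)       = ≤-reflexive (sym len)
    factorization-1≤ (block _ _ _ C _) = ≤-trans z<s (inside C)

    -- The leading word dominates the support: the first block and the rest are compared separately
    -- and joined by `≼-glue`, since the junction is a cut of `w`.
    occurs-≼ : ∀ {m u w} → Factorization m w → Occurs m u → u ≼ w
    occurs-≼ (letter len) len′ = trans len′ (sym len) ,≼ λ i<j j< _ →
      contradiction (≤-trans i<j (s≤s⁻¹ (subst (_ <_) len′ j<))) λ ()
    occurs-≼ {u = u} {w} (block {m = m} c ns refl C F) (r , o) =
      ≼-glue C same (≼-trans (subst (λ k → take k u ≼ std (take (suc c) w)) len (R⇒≼ r)) (proj₂ (std-≈ʷ (take (suc c) w)))) rest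
      where
      len = block-length {w} (inside C)
      rest : drop c u ≼ drop c w
      rest = occurs-≼ F (subst (λ k → Occurs m (drop (k ∸ 1) u)) len o)
      differences : length u ∸ c ≡ length w ∸ c
      differences = trans (sym (length-drop c u)) (trans (same-length rest) (length-drop c w))
      -- Subtraction is truncated, so equal differences give equal lengths only once `u` is known to
      -- reach `c`; the difference for `w` is positive.
      c≤u : c ≤ length u
      c≤u with ≤-total c (length u)
      ... | inj₁ c≤u = c≤u
      ... | inj₂ u≤c = contradiction (subst (0 <_) (trans (sym differences) (m≤n⇒m∸n≡0 u≤c)) (m<n⇒0<n∸m (inside C))) λ ()
      same : length u ≡ length w
      same = ∸-cancelʳ-≡ c≤u (<⇒≤ (inside C)) differences

    evalMon-std : ∀ {m} → All NonSecable m → ∀ w → evalMon gen m w ≈ evalMon gen m (std w)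
    evalMon-std {m} nss w = indicator-⇔ (occurs-resp m (std-≈ʷ w)) (occurs-resp m (≈ʷ-sym (std-≈ʷ w)))
      (evalMon-indicator nss w) (evalMon-indicator nss (std w))

    evalMon-support : ∀ {m w} → Factorization m w → ∀ u → length u ≢ length w → evalMon gen m u ≈ 0#
    evalMon-support F u len≢ = indicator-false (evalMon-indicator (factorization-nonSecable F) u)
      (len≢ ∘ same-length ∘ occurs-≼ F)

    -- Membership in FQSym, spanning and linear independence

    evalMon-∈FQSym : ∀ m → All NonSecable m → InFQSym (evalMon gen m)
    -- The length of a leading word is the single degree in which the monomial lives.
    evalMon-∈FQSym m nss with w , F ← realize m nss =
      coordinates (evalMon gen m) (length w)
      , All.tabulate (λ {p} p∈ → let perm , len = ∈-permutations⁻ {length w} (proj₂ (∈-coordinates {evalMon gen m} {length w} p∈)) in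
          perm , subst (1 ≤_) (sym len) (factorization-1≤ F))
      , G-expansion (evalMon gen m) (length w) (evalMon-std nss) (evalMon-support F)

    -- Subtracting the monomial of the factorization of `σ` leaves a remainder `h` whose nonzero
    -- coordinates sit at permutations with fewer inversions; `N` bounds the inversion number.
    G-∈span : ∀ σ → PosPerm σ → InSpan (All NonSecable) (evalMon gen) (G σ)
    G-∈span σ = go (suc (inv σ)) σ ≤-refl
      where
      go : ∀ N σ → inv σ < N → PosPerm σ → InSpan (All NonSecable) (evalMon gen) (G σ)
      go (suc N) σ inv< (perm , 1≤) with m , F ← factorize σ 1≤ =
        span-cong (evalMon gen) split (span-+ (evalMon gen) (span-generator (evalMon gen) nss) remainder)
        where
        n = length σ
        nss = factorization-nonSecable F
        h : Series
        h w = G σ w ⊕ ⊖ evalMon gen m w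
        split : ∀ w → G σ w ≈ evalMon gen m w ⊕ h w
        split w = K.sym (begin
          E ⊕ (G σ w ⊕ ⊖ E)   ≈⟨ K.+-congˡ (K.+-comm _ _) ⟩
          E ⊕ (⊖ E ⊕ G σ w)   ≈⟨ K.+-assoc _ _ _ ⟨
          (E ⊕ ⊖ E) ⊕ G σ w   ≈⟨ K.+-congʳ (K.-‿inverseʳ E) ⟩
          0# ⊕ G σ w          ≈⟨ K.+-identityˡ _ ⟩
          G σ w               ∎)
          where E = evalMon gen m w
        h-zero : ∀ {w x} → G σ w ≈ x → evalMon gen m w ≈ x → h w ≈ 0#
        h-zero g≈ e≈ = K.trans (K.+-cong g≈ (K.-‿cong e≈)) (K.-‿inverseʳ _)
        h-std : ∀ w → h w ≈ h (std w)
        h-std w = K.+-cong (indicator-⇔ (trans (std-idem w)) (trans (sym (std-idem w))) (G-indicator σ w) (G-indicator σ (std w)))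
          (K.-‿cong (evalMon-std nss w))
        h-support : ∀ w → length w ≢ n → h w ≈ 0#
        h-support w len≢ = h-zero (indicator-false (G-indicator σ w) λ { refl → len≢ (sym (length-std w)) })
          (evalMon-support F w len≢)
        lower : ∀ {a τ} → (a , τ) ∈ coordinates h n → a ≈ 0# ⊎ InSpan (All NonSecable) (evalMon gen) (G τ)
        lower {a} {τ} p∈ with refl , τ∈ ← ∈-coordinates {h} {n} p∈
                         with permτ , len ← ∈-permutations⁻ {n} τ∈
                         with G-indicator σ τ | evalMon-indicator nss τ
        -- Where the two coefficients agree they cancel. The case of `σ` outside the support of its
        -- own monomial is impossible; in the last case `τ` is strictly below `σ`.
        ... | inj₁ (_ , g≈1)  | inj₁ (_ , e≈1)  = inj₁ (h-zero g≈1 e≈1)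
        ... | inj₂ (_ , g≈0)  | inj₂ (_ , e≈0)  = inj₁ (h-zero g≈0 e≈0)
        ... | inj₁ (eq , _)   | inj₂ (¬o , _)   = contradiction
                (occurs-resp m (std≡⇒≈ʷ (trans (std-perm perm) (sym eq))) (factorization⇒occurs F)) ¬o
        ... | inj₂ (neq , _)  | inj₁ (o , _)    = inj₂ (go N τ (<-≤-trans smaller (s≤s⁻¹ inv<)) (permτ , subst (1 ≤_) (sym len) 1≤))
          where
          smaller : inv τ < inv σ
          smaller with inv τ <? inv σ
          ... | yes p = p
          ... | no ¬p = contradiction (trans (std-cong (τ≼σ , ≼∧inv-≥⇒≽ τ≼σ (≮⇒≥ ¬p))) (std-perm perm)) neq
            where τ≼σ = occurs-≼ F o
        remainder : InSpan (All NonSecable) (evalMon gen) h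
        remainder = span-cong (evalMon gen) (G-expansion h n h-std h-support)
          (span-lincomb (evalMon gen) G (coordinates h n) lower)

    -- The relation is evaluated at the leading word of `m`. Any other monomial nonzero there has a
    -- leading word above it, strictly so because a word determines its monomial; its coefficient is
    -- already known to vanish.
    evalMon-independent : LinIndep (All NonSecable) (evalMon gen)
    evalMon-independent l nss unique l≈0 = All.tabulate λ {(a , m)} p∈ →
      let w , F = realize m (All.lookup nss p∈) in
      -- The inversion number never exceeds the square of the length, and each recursive call raises
      -- it at constant length, so this fuel suffices.
      go (suc (length w * length w)) w F p∈ (m≤m+n _ _)
      where
      -- Downward induction on the number of inversions of the leading word of a monomial.
      go : ∀ N {a m} w → Factorization m w → (a , m) ∈ l → length w * length w < N + inv w → a ≈ 0#
      go zero    w F p∈ lt = contradiction (inv-≤ w) (<⇒≱ lt)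
      go (suc N) {a} {m} w F p∈ lt = begin
        a                          ≈⟨ K.*-identityʳ a ⟨
        a ⊗ 1#                     ≈⟨ K.*-congˡ (indicator-true (evalMon-indicator (factorization-nonSecable F) w) (factorization⇒occurs F)) ⟨
        a ⊗ evalMon gen m w        ≈⟨ lincomb-single (evalMon gen) l w unique p∈ others ⟨
        lincomb (evalMon gen) l w  ≈⟨ l≈0 w ⟩
        0#                         ∎
        where
        others : ∀ {b m′} → (b , m′) ∈ l → m′ ≢ m → b ⊗ evalMon gen m′ w ≈ 0#
        others {b} {m′} q∈ m′≢m with evalMon-indicator (All.lookup nss q∈) w
        ... | inj₂ (_ , e≈0) = K.trans (K.*-congˡ e≈0) (K.zeroʳ b)
        ... | inj₁ (o , _) with w′ , F′ ← realize m′ (All.lookup nss q∈) =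
          K.trans (K.*-congʳ (go N w′ F′ q∈ bound)) (K.zeroˡ _)
          where
          w≼w′ : w ≼ w′
          w≼w′ = occurs-≼ F′ o
          larger : inv w < inv w′
          larger with inv w <? inv w′
          ... | yes p = p
          ... | no ¬p = contradiction (factorization-unique (factorization-resp (≼∧inv-≥⇒≽ w≼w′ (≮⇒≥ ¬p) , w≼w′) F′) F) m′≢m
          bound : length w′ * length w′ < N + inv w′
          bound = subst (λ k → k * k < N + inv w′) (same-length w≼w′)
            (≤-trans lt (≤-trans (≤-reflexive (sym (+-suc N (inv w)))) (+-monoʳ-≤ N larger)))

    freelyGenerated : FreelyGenerated NonSecable gen
    freelyGenerated = evalMon-∈FQSym , G-∈span , evalMon-independent

theorem4p4 : {c ℓ : Level} (K : Field c ℓ) →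
    let open FQSymDefs K in
    FreelyGenerated NonSecable S × FreelyGenerated NonSecable G
theorem4p4 K = freelyGenerated K (S-triangular K) , freelyGenerated K (G-triangular K)
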